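{- For every integer $n\geq 1$ and every real number $q\neq 1$, $$\mathfrak{N}_n(q)=(q-1)^{n+1}\int_{0}^{\frac{q}{q-1}}P_n(2x-1)\,dx = q(q-1)^{n}\int_{0}^{1}P_n\!\left(\frac{2q}{q-1}x-1\right)dx.$$
   Context: For $n\ge 1$ the Narayana polynomial is $\mathfrak{N}_n(q)=\sum_{k=1}^n\frac{1}{n}\binom{n}{k-1}\binom{n}{k}q^{k}$. $P_n$ denotes the $n$-th Legendre polynomial, $P_n(x)=2^{ -n}\sum_{k=0}^{\lfloor n/2\rfloor}(-1)^k\binom{n-k}{k}\binom{2n-2k}{n-k}x^{n-2k}$. -}

module Defs where

open import Algebra.Bundles.Raw using (RawRing)
open import Data.Fin.Base using (Fin; zero; suc; toℕ; fromℕ; inject₁)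
open import Data.Integer.Base using (+_)
open import Data.Nat.Base as ℕ using (ℕ; zero; suc; _∸_; ⌊_/2⌋)
import Data.Nat.Properties as ℕ
open import Data.Nat.Combinatorics using (_C_)
open import Data.Product.Base using (∃-syntax; _×_; _,_)
open import Data.Rational.Base as ℚ using (ℚ; 0ℚ; 1ℚ; ½; ∣_∣)
import Data.Rational.Properties as ℚ
open import Data.Rational.Solver using (module +-*-Solver)
open import Data.Sum.Base using (_⊎_; inj₁; inj₂)
open import Level using (0ℓ)
open import Relation.Binary.PropositionalEquality
open import Relation.Nullary using (yes; no; contradiction)

------------------------------------------------------------------------
-- Rational estimates

module _ where
  open +-*-Solver

  ½-split : ∀ p → ½ ℚ.* p ℚ.+ ½ ℚ.* p ≡ p
  ½-split p = trans (sym (ℚ.*-distribʳ-+ p ½ ½)) (ℚ.*-identityˡ p)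

  +-diff : ∀ a b c d →
    (a ℚ.+ b) ℚ.- (c ℚ.+ d) ≡ (a ℚ.- c) ℚ.+ (b ℚ.- d)
  +-diff = solve 4 (λ a b c d →
    ((a :+ b) :- (c :+ d)) := ((a :- c) :+ (b :- d))) refl

  *-diff : ∀ a b c d →
    (a ℚ.* b) ℚ.- (c ℚ.* d) ≡ a ℚ.* (b ℚ.- d) ℚ.+ d ℚ.* (a ℚ.- c)
  *-diff = solve 4 (λ a b c d →
    ((a :* b) :- (c :* d)) := (a :* (b :- d) :+ d :* (a :- c))) refl

  neg-diff : ∀ a b → (ℚ.- a) ℚ.- (ℚ.- b) ≡ ℚ.- (a ℚ.- b)
  neg-diff = solve 2 (λ a b → ((:- a) :- (:- b)) := (:- (a :- b))) refl

  insert : ∀ a b → (a ℚ.- b) ℚ.+ b ≡ a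
  insert = solve 2 (λ a b → (a :- b) :+ b := a) refl

  recip-diff : ∀ r s a b →
    ((r ℚ.- s) ℚ.* a) ℚ.* b ≡ (r ℚ.* a) ℚ.* b ℚ.- (s ℚ.* b) ℚ.* a
  recip-diff = solve 4 (λ r s a b →
    ((r :- s) :* a) :* b := (r :* a) :* b :- (s :* b) :* a) refl

  shift : ∀ a e b → (a ℚ.- b) ℚ.+ e ≡ (a ℚ.+ e) ℚ.- b
  shift = solve 3 (λ a e b → (a :- b) :+ e := (a :+ e) :- b) refl

-- 1/0 = 0 by convention
recip : ℚ → ℚ
recip p with p ℚ.≟ 0ℚ
... | yes _   = 0ℚ
... | no  p≢0 = ℚ.1/_ p {{ℚ.≢-nonZero p≢0}}

recip-inverse : ∀ p → p ≢ 0ℚ → recip p ℚ.* p ≡ 1ℚ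
recip-inverse p p≢0 with p ℚ.≟ 0ℚ
... | yes p≡0 = contradiction p≡0 p≢0
... | no  q≢0 = ℚ.*-inverseˡ p {{ℚ.≢-nonZero q≢0}}

*-positive : ∀ {p q} → 0ℚ ℚ.< p → 0ℚ ℚ.< q → 0ℚ ℚ.< p ℚ.* q
*-positive {p} {q} 0<p 0<q =
  ℚ.positive⁻¹ (p ℚ.* q)
    {{ℚ.pos*pos⇒pos p {{ℚ.positive 0<p}} q {{ℚ.positive 0<q}}}}

------------------------------------------------------------------------
-- Real numbers: Cauchy sequences of rationals, up to _≃_

Eventually : (ℕ → Set) → Set
Eventually P = ∃[ N ] (∀ n → N ℕ.≤ n → P n)

record ℝ : Set where
  constructor mkℝ
  field
    seq    : ℕ → ℚ
    cauchy : ∀ ε → 0ℚ ℚ.< ε →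
             ∃[ N ] (∀ m n → N ℕ.≤ m → N ℕ.≤ n → ∣ seq m ℚ.- seq n ∣ ℚ.< ε)
open ℝ public

infix 4 _≃_ _<_ _≤_ _#_

_≃_ : ℝ → ℝ → Set
x ≃ y = ∀ ε → 0ℚ ℚ.< ε → Eventually (λ n → ∣ seq x n ℚ.- seq y n ∣ ℚ.< ε)

_<_ : ℝ → ℝ → Set
x < y = ∃[ ε ] (0ℚ ℚ.< ε × Eventually (λ n → seq x n ℚ.+ ε ℚ.≤ seq y n))

_≤_ : ℝ → ℝ → Set
x ≤ y = ∀ ε → 0ℚ ℚ.< ε → Eventually (λ n → seq x n ℚ.≤ seq y n ℚ.+ ε)

-- Apartness, the constructive form of x ≠ y; classically the two agree.
_#_ : ℝ → ℝ → Set
x # y = x < y ⊎ y < x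

fromℚ : ℚ → ℝ
fromℚ p = mkℝ (λ _ → p) λ ε 0<ε → 0 , λ _ _ _ _ →
  subst (ℚ._< ε) (cong ∣_∣ (sym (ℚ.+-inverseʳ p))) 0<ε

ℕ→ℝ : ℕ → ℝ
ℕ→ℝ n = fromℚ (+ n ℚ./ 1)

0ℝ 1ℝ 2ℝ : ℝ
0ℝ = fromℚ 0ℚ
1ℝ = fromℚ 1ℚ
2ℝ = ℕ→ℝ 2

infix  8 -_
infixl 7 _*_
infixl 6 _+_ _-_

_+_ : ℝ → ℝ → ℝ
x + y = mkℝ (λ n → seq x n ℚ.+ seq y n) λ ε 0<ε →
  let 0<½ε   = *-positive (ℚ.positive⁻¹ ½) 0<ε
      M , hx = cauchy x (½ ℚ.* ε) 0<½ε
      N , hy = cauchy y (½ ℚ.* ε) 0<½ε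
  in M ℕ.⊔ N , λ m n M⊔N≤m M⊔N≤n →
    let open ℚ.≤-Reasoning
        xm = seq x m ; xn = seq x n ; ym = seq y m ; yn = seq y n
    in begin-strict
      ∣ (xm ℚ.+ ym) ℚ.- (xn ℚ.+ yn) ∣
        ≡⟨ cong ∣_∣ (+-diff xm ym xn yn) ⟩
      ∣ (xm ℚ.- xn) ℚ.+ (ym ℚ.- yn) ∣
        ≤⟨ ℚ.∣p+q∣≤∣p∣+∣q∣ (xm ℚ.- xn) (ym ℚ.- yn) ⟩
      ∣ xm ℚ.- xn ∣ ℚ.+ ∣ ym ℚ.- yn ∣
        <⟨ ℚ.+-mono-<
             (hx m n (ℕ.m⊔n≤o⇒m≤o M N M⊔N≤m) (ℕ.m⊔n≤o⇒m≤o M N M⊔N≤n))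
             (hy m n (ℕ.m⊔n≤o⇒n≤o M N M⊔N≤m) (ℕ.m⊔n≤o⇒n≤o M N M⊔N≤n)) ⟩
      ½ ℚ.* ε ℚ.+ ½ ℚ.* ε
        ≡⟨ ½-split ε ⟩
      ε ∎

-_ : ℝ → ℝ
- x = mkℝ (λ n → ℚ.- seq x n) λ ε 0<ε →
  let N , h = cauchy x ε 0<ε
  in N , λ m n N≤m N≤n →
    subst (ℚ._< ε)
      (sym (trans (cong ∣_∣ (neg-diff (seq x m) (seq x n)))
                  (ℚ.∣-p∣≡∣p∣ (seq x m ℚ.- seq x n))))
      (h m n N≤m N≤n)

_-_ : ℝ → ℝ → ℝ
x - y = x + (- y)

bounded : ∀ x → ∃[ B ] (0ℚ ℚ.< B × Eventually (λ n → ∣ seq x n ∣ ℚ.≤ B))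
bounded x =
  let N , h = cauchy x 1ℚ (ℚ.positive⁻¹ 1ℚ)
      xN    = seq x N
  in 1ℚ ℚ.+ ∣ xN ∣ ,
     ℚ.+-mono-<-≤ (ℚ.positive⁻¹ 1ℚ) (ℚ.0≤∣p∣ xN) ,
     N , λ n N≤n →
       let open ℚ.≤-Reasoning
           xn = seq x n
       in begin
         ∣ xn ∣                    ≡⟨ cong ∣_∣ (sym (insert xn xN)) ⟩
         ∣ (xn ℚ.- xN) ℚ.+ xN ∣    ≤⟨ ℚ.∣p+q∣≤∣p∣+∣q∣ (xn ℚ.- xN) xN ⟩
         ∣ xn ℚ.- xN ∣ ℚ.+ ∣ xN ∣  ≤⟨ ℚ.+-monoˡ-≤ ∣ xN ∣
                                        (ℚ.<⇒≤ (h n N N≤n ℕ.≤-refl)) ⟩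
         1ℚ ℚ.+ ∣ xN ∣             ∎

_*_ : ℝ → ℝ → ℝ
x * y = mkℝ (λ n → seq x n ℚ.* seq y n) λ ε 0<ε →
  let A , 0<A , L , hA = bounded x
      B , 0<B , M , hB = bounded y
      K      = A ℚ.+ B
      0<K    = ℚ.+-mono-< 0<A 0<B
      K≢0    = λ K≡0 → ℚ.<⇒≢ 0<K (sym K≡0)
      1/K    = ℚ.1/_ K {{ℚ.≢-nonZero K≢0}}
      0<1/K  = ℚ.positive⁻¹ 1/K {{ℚ.1/pos⇒pos K {{ℚ.positive 0<K}}}}
      δ      = 1/K ℚ.* ε
      0<δ    = *-positive 0<1/K 0<ε
      P , hx = cauchy x δ 0<δ
      Q , hy = cauchy y δ 0<δ
      LM     = L ℕ.⊔ M
      PQ     = P ℕ.⊔ Q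
  in LM ℕ.⊔ PQ , λ m n ≤m ≤n →
    let open ℚ.≤-Reasoning
        xm = seq x m ; xn = seq x n ; ym = seq y m ; yn = seq y n
        LM≤m = ℕ.m⊔n≤o⇒m≤o LM PQ ≤m
        LM≤n = ℕ.m⊔n≤o⇒m≤o LM PQ ≤n
        PQ≤m = ℕ.m⊔n≤o⇒n≤o LM PQ ≤m
        PQ≤n = ℕ.m⊔n≤o⇒n≤o LM PQ ≤n
        Δx<δ = hx m n (ℕ.m⊔n≤o⇒m≤o P Q PQ≤m) (ℕ.m⊔n≤o⇒m≤o P Q PQ≤n)
        Δy<δ = hy m n (ℕ.m⊔n≤o⇒n≤o P Q PQ≤m) (ℕ.m⊔n≤o⇒n≤o P Q PQ≤n)
        xm≤A = hA m (ℕ.m⊔n≤o⇒m≤o L M LM≤m)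
        yn≤B = hB n (ℕ.m⊔n≤o⇒n≤o L M LM≤n)
    in begin-strict
      ∣ xm ℚ.* ym ℚ.- xn ℚ.* yn ∣
        ≡⟨ cong ∣_∣ (*-diff xm ym xn yn) ⟩
      ∣ xm ℚ.* (ym ℚ.- yn) ℚ.+ yn ℚ.* (xm ℚ.- xn) ∣
        ≤⟨ ℚ.∣p+q∣≤∣p∣+∣q∣ (xm ℚ.* (ym ℚ.- yn)) (yn ℚ.* (xm ℚ.- xn)) ⟩
      ∣ xm ℚ.* (ym ℚ.- yn) ∣ ℚ.+ ∣ yn ℚ.* (xm ℚ.- xn) ∣
        ≡⟨ cong₂ ℚ._+_ (ℚ.∣p*q∣≡∣p∣*∣q∣ xm (ym ℚ.- yn))
                       (ℚ.∣p*q∣≡∣p∣*∣q∣ yn (xm ℚ.- xn)) ⟩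
      ∣ xm ∣ ℚ.* ∣ ym ℚ.- yn ∣ ℚ.+ ∣ yn ∣ ℚ.* ∣ xm ℚ.- xn ∣
        ≤⟨ ℚ.+-mono-≤
             (ℚ.*-monoʳ-≤-nonNeg ∣ ym ℚ.- yn ∣ {{ℚ.∣-∣-nonNeg (ym ℚ.- yn)}} xm≤A)
             (ℚ.*-monoʳ-≤-nonNeg ∣ xm ℚ.- xn ∣ {{ℚ.∣-∣-nonNeg (xm ℚ.- xn)}} yn≤B) ⟩
      A ℚ.* ∣ ym ℚ.- yn ∣ ℚ.+ B ℚ.* ∣ xm ℚ.- xn ∣
        <⟨ ℚ.+-mono-< (ℚ.*-monoʳ-<-pos A {{ℚ.positive 0<A}} Δy<δ)
                      (ℚ.*-monoʳ-<-pos B {{ℚ.positive 0<B}} Δx<δ) ⟩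
      A ℚ.* δ ℚ.+ B ℚ.* δ
        ≡⟨ sym (ℚ.*-distribʳ-+ δ A B) ⟩
      K ℚ.* (1/K ℚ.* ε)
        ≡⟨ sym (ℚ.*-assoc K 1/K ε) ⟩
      K ℚ.* 1/K ℚ.* ε
        ≡⟨ cong (ℚ._* ε) (ℚ.*-inverseʳ K {{ℚ.≢-nonZero K≢0}}) ⟩
      1ℚ ℚ.* ε
        ≡⟨ ℚ.*-identityˡ ε ⟩
      ε ∎

awayFromZero : ∀ x → x # 0ℝ →
  ∃[ η ] (0ℚ ℚ.< η × Eventually (λ n → η ℚ.≤ ∣ seq x n ∣))
awayFromZero x (inj₁ (η , 0<η , N , h)) = η , 0<η , N , λ n N≤n →
  let open ℚ.≤-Reasoning
      xn = seq x n
  in begin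
    η                        ≡⟨ sym (ℚ.+-identityʳ η) ⟩
    η ℚ.+ 0ℚ                 ≡⟨ cong (η ℚ.+_) (sym (ℚ.+-inverseʳ xn)) ⟩
    η ℚ.+ (xn ℚ.- xn)        ≡⟨ sym (ℚ.+-assoc η xn (ℚ.- xn)) ⟩
    η ℚ.+ xn ℚ.- xn          ≡⟨ cong (ℚ._- xn) (ℚ.+-comm η xn) ⟩
    xn ℚ.+ η ℚ.- xn          ≤⟨ ℚ.+-monoˡ-≤ (ℚ.- xn) (h n N≤n) ⟩
    0ℚ ℚ.- xn                ≡⟨ ℚ.+-identityˡ (ℚ.- xn) ⟩
    ℚ.- xn                   ≤⟨ p≤∣p∣ (ℚ.- xn) ⟩
    ∣ ℚ.- xn ∣               ≡⟨ ℚ.∣-p∣≡∣p∣ xn ⟩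
    ∣ xn ∣                   ∎
  where
  p≤∣p∣ : ∀ p → p ℚ.≤ ∣ p ∣
  p≤∣p∣ p with ℚ.≤-total 0ℚ p
  ... | inj₁ 0≤p = ℚ.≤-reflexive (sym (ℚ.0≤p⇒∣p∣≡p 0≤p))
  ... | inj₂ p≤0 = ℚ.≤-trans p≤0 (ℚ.0≤∣p∣ p)
awayFromZero x (inj₂ (η , 0<η , N , h)) = η , 0<η , N , λ n N≤n →
  let η≤xn = ℚ.≤-trans (ℚ.≤-reflexive (sym (ℚ.+-identityˡ η))) (h n N≤n)
      0≤xn = ℚ.≤-trans (ℚ.<⇒≤ 0<η) η≤xn
  in ℚ.≤-trans η≤xn (ℚ.≤-reflexive (sym (ℚ.0≤p⇒∣p∣≡p 0≤xn)))

inverse : (x : ℝ) → x # 0ℝ → ℝ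
inverse x x#0 = mkℝ (λ n → recip (seq x n)) λ ε 0<ε →
  let η , 0<η , M , away = awayFromZero x x#0
      0<ηη  = *-positive 0<η 0<η
      N , h = cauchy x (ε ℚ.* (η ℚ.* η)) (*-positive 0<ε 0<ηη)
  in M ℕ.⊔ N , λ m n ≤m ≤n →
    let open ℚ.≤-Reasoning
        a = seq x m ; b = seq x n ; r = recip a ; s = recip b
        η≤a = away m (ℕ.m⊔n≤o⇒m≤o M N ≤m)
        η≤b = away n (ℕ.m⊔n≤o⇒m≤o M N ≤n)
        D   = ∣ r ℚ.- s ∣
        nonzero = λ p η≤p p≡0 →
          ℚ.<-irrefl refl (ℚ.<-≤-trans 0<η (ℚ.≤-trans η≤p (ℚ.≤-reflexive (cong ∣_∣ {p} {0ℚ} p≡0))))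
        nnD = ℚ.∣-∣-nonNeg (r ℚ.- s)
    in ℚ.*-cancelʳ-<-nonNeg (η ℚ.* η)
         {{ℚ.nonNegative (ℚ.<⇒≤ 0<ηη)}} (begin-strict
      D ℚ.* (η ℚ.* η)
        ≤⟨ ℚ.*-monoˡ-≤-nonNeg D {{nnD}} (ℚ.≤-trans
             (ℚ.*-monoʳ-≤-nonNeg η {{ℚ.nonNegative (ℚ.<⇒≤ 0<η)}} η≤a)
             (ℚ.*-monoˡ-≤-nonNeg ∣ a ∣ {{ℚ.∣-∣-nonNeg a}} η≤b)) ⟩
      D ℚ.* (∣ a ∣ ℚ.* ∣ b ∣)
        ≡⟨ sym (ℚ.*-assoc D ∣ a ∣ ∣ b ∣) ⟩
      D ℚ.* ∣ a ∣ ℚ.* ∣ b ∣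
        ≡⟨ cong (ℚ._* ∣ b ∣) (sym (ℚ.∣p*q∣≡∣p∣*∣q∣ (r ℚ.- s) a)) ⟩
      ∣ (r ℚ.- s) ℚ.* a ∣ ℚ.* ∣ b ∣
        ≡⟨ sym (ℚ.∣p*q∣≡∣p∣*∣q∣ ((r ℚ.- s) ℚ.* a) b) ⟩
      ∣ (r ℚ.- s) ℚ.* a ℚ.* b ∣
        ≡⟨ cong ∣_∣ (recip-diff r s a b) ⟩
      ∣ (r ℚ.* a) ℚ.* b ℚ.- (s ℚ.* b) ℚ.* a ∣
        ≡⟨ cong₂ (λ u v → ∣ u ℚ.* b ℚ.- v ℚ.* a ∣)
             (recip-inverse a (nonzero a η≤a)) (recip-inverse b (nonzero b η≤b)) ⟩
      ∣ 1ℚ ℚ.* b ℚ.- 1ℚ ℚ.* a ∣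
        ≡⟨ cong₂ (λ u v → ∣ u ℚ.- v ∣) (ℚ.*-identityˡ b) (ℚ.*-identityˡ a) ⟩
      ∣ b ℚ.- a ∣
        <⟨ h n m (ℕ.m⊔n≤o⇒n≤o M N ≤n) (ℕ.m⊔n≤o⇒n≤o M N ≤m) ⟩
      ε ℚ.* (η ℚ.* η) ∎)

x#y⇒x-y#0 : ∀ x y → x # y → x - y # 0ℝ
x#y⇒x-y#0 x y (inj₁ (ε , 0<ε , N , h)) = inj₁ (ε , 0<ε , N , λ n N≤n →
  let open ℚ.≤-Reasoning
      xn = seq x n ; yn = seq y n
  in begin
    (xn ℚ.- yn) ℚ.+ ε  ≡⟨ shift xn ε yn ⟩
    (xn ℚ.+ ε) ℚ.- yn  ≤⟨ ℚ.+-monoˡ-≤ (ℚ.- yn) (h n N≤n) ⟩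
    yn ℚ.- yn          ≡⟨ ℚ.+-inverseʳ yn ⟩
    0ℚ                 ∎)
x#y⇒x-y#0 x y (inj₂ (ε , 0<ε , N , h)) = inj₂ (ε , 0<ε , N , λ n N≤n →
  let open ℚ.≤-Reasoning
      xn = seq x n ; yn = seq y n
  in begin
    0ℚ ℚ.+ ε           ≡⟨ cong (ℚ._+ ε) (sym (ℚ.+-inverseʳ yn)) ⟩
    (yn ℚ.- yn) ℚ.+ ε  ≡⟨ shift yn ε yn ⟩
    (yn ℚ.+ ε) ℚ.- yn  ≤⟨ ℚ.+-monoˡ-≤ (ℚ.- yn) (h n N≤n) ⟩
    xn ℚ.- yn          ∎)

infixl 7 _/_[_]

_/_[_] : (x y : ℝ) → y # 0ℝ → ℝ
x / y [ y#0 ] = x * inverse y y#0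

ℝ-rawRing : RawRing 0ℓ 0ℓ
ℝ-rawRing = record
  { Carrier = ℝ ; _≈_ = _≃_ ; _+_ = _+_ ; _*_ = _*_ ; -_ = -_
  ; 0# = 0ℝ ; 1# = 1ℝ }

open import Algebra.Definitions.RawSemiring (RawRing.rawSemiring ℝ-rawRing) public
  using (_^_; sum)

------------------------------------------------------------------------
-- The Riemann integral

record TaggedPartition (a b : ℝ) : Set where
  field
    size      : ℕ
    point     : Fin (suc size) → ℝ
    tag       : Fin size → ℝ
    start     : point zero ≃ a
    end       : point (fromℕ size) ≃ b
    point≤tag : ∀ i → point (inject₁ i) ≤ tag i
    tag≤point : ∀ i → tag i ≤ point (suc i)

  width : Fin size → ℝ
  width i = point (suc i) - point (inject₁ i)

open TaggedPartition public

riemannSum : (ℝ → ℝ) → ∀ {a b} → TaggedPartition a b → ℝ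
riemannSum f π = sum λ i → f (tag π i) * width π i

-- I = ∫ₐᵇ f for a ≤ b
IsRiemannIntegral : (ℝ → ℝ) → ℝ → ℝ → ℝ → Set
IsRiemannIntegral f a b I =
  ∀ ε → 0ℝ < ε → ∃[ δ ] (0ℝ < δ ×
    ((π : TaggedPartition a b) → (∀ i → width π i < δ) →
      (- ε < riemannSum f π - I) × (riemannSum f π - I < ε)))

-- I = ∫ₐᵇ f for endpoints in either order, with ∫ₐᵇ f = - ∫ᵇₐ f.  It is
-- stated by two implications because a ≤ b ⊎ b ≤ a is not decidable; as _≃_
-- is stable under double negation, they still determine I.
IsIntegral : (ℝ → ℝ) → ℝ → ℝ → ℝ → Set
IsIntegral f a b I =
  (a ≤ b → IsRiemannIntegral f a b I) ×
  (b ≤ a → IsRiemannIntegral f b a (- I))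

------------------------------------------------------------------------
-- Narayana and Legendre polynomials

-- Summed over j = k - 1.
𝔑 : (n : ℕ) → .{{_ : ℕ.NonZero n}} → ℝ → ℝ
𝔑 n q = sum {n} λ i → let j = toℕ i in
  fromℚ (+ ((n C j) ℕ.* (n C suc j)) ℚ./ n) * q ^ suc j

P : ℕ → ℝ → ℝ
P n x = fromℚ ½ ^ n * sum {suc ⌊ n /2⌋} λ i → let k = toℕ i in
  (- 1ℝ) ^ k
    * ℕ→ℝ (((n ∸ k) C k) ℕ.* ((2 ℕ.* n ∸ 2 ℕ.* k) C (n ∸ k)))
    * x ^ (n ∸ 2 ℕ.* k)

{-# OPTIONS --safe #-}

-- Write y = q/(q - 1), so that y - 1 = 1/(q - 1), and let ν k be the coefficient
-- of q^(k+1) in 𝔑 n.  Then 𝔑 n q = (q - 1)^(n+1) F(y) for the polynomial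
-- F(y) = Σ_k ν k y^(k+1) (y - 1)^(n-k), which vanishes at 0.  Differentiating
-- termwise, F′(y) = Σ_i (n C i)² y^i (y - 1)^(n-i).  This is the coefficient of
-- tⁿ in (t + y)ⁿ (t + y - 1)ⁿ = ((t + x/2)² - 1/4)ⁿ with x = 2y - 1, and expanding
-- the latter power gives P n x.  The second integral comes from the homogenised
-- antiderivative Σ_k ν k x (z x)^k (z x - 1)^(n-k) of P n (2 z x - 1), with
-- parameter z = y in place of z = 1.
--
-- All operations on ℝ act index by index on Cauchy sequences, so the algebra
-- takes place in ℚ.  A polynomial F satisfies F v - F u = (v - u) Q(u, v) with Q
-- Lipschitz on bounded sets and F′ t = Q(t, t); over an interval of length at
-- most δ this bounds the error of a Riemann sum by a multiple of δ (v - u).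

module Submission where

open import Data.Nat.Base as ℕ using (ℕ; zero; suc; NonZero; _∸_; _!; ⌊_/2⌋; z≤n; s≤s)
open import Data.Fin.Base using (Fin; zero; suc; toℕ; fromℕ; inject₁)
open import Data.Integer.Base using (+_)
open import Data.Nat.Combinatorics using (_C_; nCk+nC[k+1]≡[n+1]C[k+1]; k>n⇒nCk≡0;
  nCk≡nC[n∸k]; nCk≡n!/k![n-k]!; k![n∸k]!∣n!)
open import Data.Product.Base using (∃-syntax; _×_; _,_)
open import Data.Rational.Base as ℚ using (ℚ; 0ℚ; 1ℚ; ½)
open import Data.Rational.Properties as ℚ using (+-*-commutativeRing)
open import Data.Rational.Solver using (module +-*-Solver)
open import Data.Sum.Base using (_⊎_; inj₁; inj₂)
open import Algebra.Bundles using (CommutativeRing)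
open import Function.Base using (_∘_)
open import Relation.Binary.PropositionalEquality
open import Relation.Nullary.Decidable.Core using (yes; no)
open import Relation.Nullary.Negation.Core using (contradiction; ¬_)
import Algebra.Properties.CommutativeSemiring.Exp (CommutativeRing.commutativeSemiring +-*-commutativeRing) as ℚ^
import Algebra.Properties.Semiring.Sum (CommutativeRing.semiring +-*-commutativeRing) as ℚΣ
import Data.Integer.Base as ℤ
import Data.Integer.Properties as ℤ
import Data.Nat.DivMod as ℕ
import Data.Nat.Properties as ℕ
import Data.Nat.Solver as ℕ-Solver
import Data.Rational.Unnormalised.Base as ℚᵘ
import Data.Rational.Unnormalised.Properties as ℚᵘ
import Defs as D

-- The polynomial F comes from homogenising: y (q - 1) = q and (y - 1)(q - 1) = 1, so for k ≤ n the
-- power q^(k+1) equals (q - 1)^(n+1) y^(k+1) (y - 1)^(n-k). For the second integral one would like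
-- F(y x)/y, but y is 0 when q is, and whether a Cauchy real is 0 cannot be decided. Since the
-- variable divides F as a polynomial, carrying out the division symbolically leaves a polynomial in
-- z and x that makes sense for every z. For the same reason there is no case distinction on the
-- order of points and tags. Divided differences that are themselves polynomials take the place of
-- the mean value theorem and supply uniform explicit constants. Equations involving 1/(q - 1) hold
-- only from some index on, because early approximations of q may equal 1.

module Identities where
  open import Data.Rational.Base using (_+_; _*_; _-_; -_; _/_)
  open import Data.Rational.Properties hiding (_≤?_)
  open ℚ^
  open ℚΣ
  open ≡-Reasoning

  -- Natural numbers inside ℚ and finite sums.

  ι : ℕ → ℚ
  ι n = + n / 1

  ι-+ : ∀ m n → ι (m ℕ.+ n) ≡ ι m + ι n
  ι-+ m n = toℚᵘ-injective (ℚᵘ.≃-trans (toℚᵘ-fromℚᵘ (ℚᵘ.mkℚᵘ (+ (m ℕ.+ n)) 0))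
    (ℚᵘ.≃-sym (ℚᵘ.≃-trans (toℚᵘ-homo-+ (ι m) (ι n))
      (ℚᵘ.≃-trans (ℚᵘ.+-cong (toℚᵘ-fromℚᵘ (ℚᵘ.mkℚᵘ (+ m) 0)) (toℚᵘ-fromℚᵘ (ℚᵘ.mkℚᵘ (+ n) 0)))
        (ℚᵘ.*≡* (cong (ℤ._* + 1) (trans (cong₂ ℤ._+_ (ℤ.*-identityʳ (+ m)) (ℤ.*-identityʳ (+ n))) (sym (ℤ.pos-+ m n)))))))))

  ι-* : ∀ m n → ι (m ℕ.* n) ≡ ι m * ι n
  ι-* m n = toℚᵘ-injective (ℚᵘ.≃-trans (toℚᵘ-fromℚᵘ (ℚᵘ.mkℚᵘ (+ (m ℕ.* n)) 0))
    (ℚᵘ.≃-sym (ℚᵘ.≃-trans (toℚᵘ-homo-* (ι m) (ι n))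
      (ℚᵘ.≃-trans (ℚᵘ.*-cong (toℚᵘ-fromℚᵘ (ℚᵘ.mkℚᵘ (+ m) 0)) (toℚᵘ-fromℚᵘ (ℚᵘ.mkℚᵘ (+ n) 0)))
        (ℚᵘ.*≡* (cong (ℤ._* + 1) (sym (ℤ.pos-* m n))))))))

  /-*-cancel : ∀ m n .{{_ : ℕ.NonZero n}} → (+ m / n) * ι n ≡ ι m
  /-*-cancel m n@(suc d) = toℚᵘ-injective (ℚᵘ.≃-trans (toℚᵘ-homo-* (+ m / n) (ι n))
    (ℚᵘ.≃-trans (ℚᵘ.*-cong (toℚᵘ-fromℚᵘ (ℚᵘ.mkℚᵘ (+ m) d)) (toℚᵘ-fromℚᵘ (ℚᵘ.mkℚᵘ (+ n) 0)))
      (ℚᵘ.≃-trans (ℚᵘ.*≡* (trans (ℤ.*-identityʳ _) (cong (λ k → + m ℤ.* + k) (sym (ℕ.*-identityʳ n)))))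
        (ℚᵘ.≃-sym (toℚᵘ-fromℚᵘ (ℚᵘ.mkℚᵘ (+ m) 0))))))

  sum-zero : ∀ N {g : ℕ → ℚ} → (∀ k → k ℕ.< N → g k ≡ 0ℚ) → sum {N} (g ∘ toℕ) ≡ 0ℚ
  sum-zero zero    h = refl
  sum-zero (suc N) h = cong₂ _+_ (h 0 (s≤s z≤n)) (sum-zero N (λ k k<N → h (suc k) (s≤s k<N)))

  -- Lets a sum with a short range, such as the one up to `⌊ n /2⌋`, be compared with a sum up to
  -- `n`.
  sum-extend : ∀ {m N} → m ℕ.≤ N → {g g′ : ℕ → ℚ} →
    (∀ k → k ℕ.< m → g k ≡ g′ k) →
    (∀ k → m ℕ.≤ k → k ℕ.< N → g′ k ≡ 0ℚ) →
    sum {m} (g ∘ toℕ) ≡ sum {N} (g′ ∘ toℕ)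
  sum-extend {zero}  {N}     z≤n       eq vanish = sym (sum-zero N (λ k → vanish k z≤n))
  sum-extend {suc m} {suc N} (s≤s m≤N) eq vanish =
    cong₂ _+_ (eq 0 (s≤s z≤n))
      (sum-extend m≤N (λ k k<m → eq (suc k) (s≤s k<m))
                      (λ k m≤k k<N → vanish (suc k) (s≤s m≤k) (s≤s k<N)))

  sum-cong : ∀ N {g g′ : ℕ → ℚ} → (∀ k → k ℕ.< N → g k ≡ g′ k) →
    sum {N} (g ∘ toℕ) ≡ sum {N} (g′ ∘ toℕ)
  sum-cong N eq = sum-extend ℕ.≤-refl eq (λ k N≤k k<N → contradiction N≤k (ℕ.<⇒≱ k<N))

  sum-last : ∀ n (g : ℕ → ℚ) → sum {suc n} (g ∘ toℕ) ≡ sum {n} (g ∘ toℕ) + g n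
  sum-last zero    g = +-comm (g 0) 0ℚ
  sum-last (suc n) g = trans (cong (_+_ (g 0)) (sum-last n (g ∘ suc))) (sym (+-assoc (g 0) _ _))

  sum-reverse : ∀ n (g : ℕ → ℚ) → sum {suc n} (g ∘ toℕ) ≡ sum {suc n} (λ i → g (n ∸ toℕ i))
  sum-reverse zero    g = refl
  sum-reverse (suc n) g = begin
    sum {suc (suc n)} (g ∘ toℕ)                        ≡⟨ sum-last (suc n) g ⟩
    sum {suc n} (g ∘ toℕ) + g (suc n)                  ≡⟨ +-comm _ (g (suc n)) ⟩
    g (suc n) + sum {suc n} (g ∘ toℕ)                  ≡⟨ cong (_+_ (g (suc n))) (sum-reverse n g) ⟩
    g (suc n) + sum {suc n} (λ i → g (n ∸ toℕ i))      ∎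

  -- Binomial expansions by shift operators.

  -- The coefficient of t^k in (t + β)^n. For `n < k` the truncated exponent does no harm, as the
  -- binomial coefficient vanishes.
  binom : ℚ → ℕ → ℕ → ℚ
  binom β n k = ι (n C k) * β ^ (n ∸ k)

  binom-vanish : ∀ β {n k} → n ℕ.< k → binom β n k ≡ 0ℚ
  binom-vanish β {n} {k} n<k = trans (cong (λ c → ι c * β ^ (n ∸ k)) (k>n⇒nCk≡0 n<k)) (*-zeroˡ (β ^ (n ∸ k)))

  -- Splitting off a factor `β` needs `n ∸ k` to be positive; otherwise `n C suc k` is zero and both
  -- sides vanish.
  binom-step : ∀ β n k → ι (n C suc k) * β ^ (n ∸ k) ≡ β * binom β n (suc k)
  binom-step β n k = by-cases (ℕ.≤-<-connex n k)
    where
    open +-*-Solver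
    by-cases : n ℕ.≤ k ⊎ k ℕ.< n → ι (n C suc k) * β ^ (n ∸ k) ≡ β * binom β n (suc k)
    by-cases (inj₁ n≤k) = begin
      ι (n C suc k) * β ^ (n ∸ k)            ≡⟨ cong (λ c → ι c * β ^ (n ∸ k)) (k>n⇒nCk≡0 (s≤s n≤k)) ⟩
      0ℚ * β ^ (n ∸ k)                       ≡⟨ *-zeroˡ (β ^ (n ∸ k)) ⟩
      0ℚ                                     ≡⟨ *-zeroʳ β ⟨
      β * 0ℚ                                 ≡⟨ cong (β *_) (binom-vanish β (s≤s n≤k)) ⟨
      β * binom β n (suc k)                  ∎
    by-cases (inj₂ k<n) = begin
      ι (n C suc k) * β ^ (n ∸ k)            ≡⟨ cong (λ j → ι (n C suc k) * β ^ j) (ℕ.+-∸-assoc 1 k<n) ⟩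
      ι (n C suc k) * (β * β ^ (n ∸ suc k))  ≡⟨ solve 3 (λ c b p → c :* (b :* p) := b :* (c :* p)) refl (ι (n C suc k)) β _ ⟩
      β * (ι (n C suc k) * β ^ (n ∸ suc k))  ∎

  binom-zero : ∀ β n → binom β (suc n) 0 ≡ β * binom β n 0
  binom-zero β n = solve 2 (λ b p → con 1ℚ :* (b :* p) := b :* (con 1ℚ :* p)) refl β (β ^ n)
    where open +-*-Solver

  binom-pascal : ∀ β n k → binom β (suc n) (suc k) ≡ binom β n k + β * binom β n (suc k)
  binom-pascal β n k = begin
    ι (suc n C suc k) * β ^ (n ∸ k)                          ≡⟨ cong (λ c → ι c * β ^ (n ∸ k)) (nCk+nC[k+1]≡[n+1]C[k+1] n k) ⟨
    ι (n C k ℕ.+ n C suc k) * β ^ (n ∸ k)                    ≡⟨ cong (_* β ^ (n ∸ k)) (ι-+ (n C k) (n C suc k)) ⟩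
    (ι (n C k) + ι (n C suc k)) * β ^ (n ∸ k)                ≡⟨ *-distribʳ-+ (β ^ (n ∸ k)) (ι (n C k)) _ ⟩
    binom β n k + ι (n C suc k) * β ^ (n ∸ k)                ≡⟨ cong (_+_ (binom β n k)) (binom-step β n k) ⟩
    binom β n k + β * binom β n (suc k)                      ∎

  -- The binomial theorem for operators: by the recurrence, a step in `n` applies shift plus `β` to
  -- the sequence in `m`, and the shift commutes with the scalar. Every `N` above `n` is allowed
  -- because the induction needs the previous row at the two lengths `N` and `suc N`.
  binomial-expansion : ∀ β (U : ℕ → ℕ → ℚ) →
    (∀ n m → U (suc n) m ≡ U n (suc m) + β * U n m) →
    ∀ n N → n ℕ.< N → ∀ m → U n m ≡ sum {N} (λ i → binom β n (toℕ i) * U 0 (m ℕ.+ toℕ i))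
  binomial-expansion β U rec zero (suc N) _ m = sym (begin
    1ℚ * 1ℚ * U 0 (m ℕ.+ 0) + rest ≡⟨ cong₂ (λ j r → 1ℚ * 1ℚ * U 0 j + r) (ℕ.+-identityʳ m) rest≡0 ⟩
    1ℚ * 1ℚ * U 0 m + 0ℚ           ≡⟨ solve 1 (λ u → con 1ℚ :* con 1ℚ :* u :+ con 0ℚ := u) refl (U 0 m) ⟩
    U 0 m                          ∎)
    where
    open +-*-Solver
    rest = sum {N} (λ i → binom β 0 (suc (toℕ i)) * U 0 (m ℕ.+ suc (toℕ i)))
    rest≡0 : rest ≡ 0ℚ
    rest≡0 = sum-zero N (λ k _ → trans (cong (_* U 0 (m ℕ.+ suc k)) (binom-vanish β {0} {suc k} (s≤s z≤n))) (*-zeroˡ (U 0 (m ℕ.+ suc k))))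
  binomial-expansion β U rec (suc n) (suc N) (s≤s n<N) m = begin
    U (suc n) m                                     ≡⟨ rec n m ⟩
    U n (suc m) + β * U n m                         ≡⟨ cong₂ (λ u v → u + β * v)
                                                         (binomial-expansion β U rec n N n<N (suc m))
                                                         (binomial-expansion β U rec n (suc N) (ℕ.m≤n⇒m≤1+n n<N) m) ⟩
    sum {N} (λ i → binom β n (toℕ i) * U 0 (suc m ℕ.+ toℕ i))
      + β * (binom β n 0 * u₀ + sum {N} (λ i → b (suc (toℕ i)) * u (toℕ i)))
      ≡⟨ cong (_+ β * (binom β n 0 * u₀ + sum {N} (λ i → b (suc (toℕ i)) * u (toℕ i))))
           (sum-cong N (λ k _ → cong (λ j → b k * U 0 j) (sym (ℕ.+-suc m k)))) ⟩
    sum {N} (λ i → b (toℕ i) * u (toℕ i))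
      + β * (b 0 * u₀ + sum {N} (λ i → b (suc (toℕ i)) * u (toℕ i)))
      ≡⟨ solve 5 (λ s β b u t → s :+ β :* (b :* u :+ t) := (β :* b) :* u :+ (s :+ β :* t)) refl
           (sum {N} (λ i → b (toℕ i) * u (toℕ i))) β (b 0) u₀ (sum {N} (λ i → b (suc (toℕ i)) * u (toℕ i))) ⟩
    (β * b 0) * u₀ + (sum {N} (λ i → b (toℕ i) * u (toℕ i)) + β * sum {N} (λ i → b (suc (toℕ i)) * u (toℕ i)))
      ≡⟨ cong₂ (λ p s → p * u₀ + (sum {N} (λ i → b (toℕ i) * u (toℕ i)) + s)) (sym (binom-zero β n))
           (*-distribˡ-sum {N} β (λ i → b (suc (toℕ i)) * u (toℕ i))) ⟩
    binom β (suc n) 0 * u₀ + (sum {N} (λ i → b (toℕ i) * u (toℕ i)) + sum {N} (λ i → β * (b (suc (toℕ i)) * u (toℕ i))))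
      ≡⟨ cong (_+_ (binom β (suc n) 0 * u₀)) (∑-distrib-+ {N} (λ i → b (toℕ i) * u (toℕ i)) (λ i → β * (b (suc (toℕ i)) * u (toℕ i)))) ⟨
    binom β (suc n) 0 * u₀ + sum {N} (λ i → b (toℕ i) * u (toℕ i) + β * (b (suc (toℕ i)) * u (toℕ i)))
      ≡⟨ cong (_+_ (binom β (suc n) 0 * u₀)) (sum-cong N (λ k _ → merge k)) ⟩
    binom β (suc n) 0 * u₀ + sum {N} (λ i → binom β (suc n) (suc (toℕ i)) * u (toℕ i)) ∎
    where
    open +-*-Solver
    b = binom β n
    u = λ k → U 0 (m ℕ.+ suc k)
    u₀ = U 0 (m ℕ.+ 0)
    merge : ∀ k → b k * u k + β * (b (suc k) * u k) ≡ binom β (suc n) (suc k) * u k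
    merge k = trans (solve 4 (λ b c β u → b :* u :+ β :* (c :* u) := (b :+ β :* c) :* u) refl (b k) (b (suc k)) β (u k))
                    (cong (_* u k) (sym (binom-pascal β n k)))

  -- Read `s` as the linear functional sending t^m to `s m`; then `E+ a s` is that functional
  -- precomposed with multiplication by t + a.
  E+ : ℚ → (ℕ → ℚ) → ℕ → ℚ
  E+ a s m = s (suc m) + a * s m

  E+^ : ℚ → ℕ → (ℕ → ℚ) → ℕ → ℚ
  E+^ a zero    s = s
  E+^ a (suc n) s = E+ a (E+^ a n s)

  E+-cong : ∀ a {s t} → s ≗ t → E+ a s ≗ E+ a t
  E+-cong a s≗t m = cong₂ (λ u v → u + a * v) (s≗t (suc m)) (s≗t m)

  E+-comm : ∀ a b s → E+ a (E+ b s) ≗ E+ b (E+ a s)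
  E+-comm a b s m = solve 5 (λ a b u v w → (w :+ b :* v) :+ a :* (v :+ b :* u) :=
    (w :+ a :* v) :+ b :* (v :+ a :* u)) refl a b (s m) (s (suc m)) (s (suc (suc m)))
    where open +-*-Solver

  E+^-comm : ∀ a b n s → E+^ a n (E+ b s) ≗ E+ b (E+^ a n s)
  E+^-comm a b zero    s m = refl
  E+^-comm a b (suc n) s m = trans (E+-cong a (E+^-comm a b n s) m) (E+-comm a b (E+^ a n s) m)

  E+^-expansion : ∀ a s n N → n ℕ.< N → ∀ m →
    E+^ a n s m ≡ sum {N} (λ i → binom a n (toℕ i) * s (m ℕ.+ toℕ i))
  E+^-expansion a s = binomial-expansion a (λ n → E+^ a n s) (λ _ _ → refl)

  δ : ℕ → ℕ → ℚ
  δ zero    zero    = 1ℚ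
  δ zero    (suc m) = 0ℚ
  δ (suc p) zero    = 0ℚ
  δ (suc p) (suc m) = δ p m

  δ-shift : ∀ {i p} → i ℕ.≤ p → ∀ j → δ p (i ℕ.+ j) ≡ δ (p ∸ i) j
  δ-shift z≤n       j = refl
  δ-shift (s≤s i≤p) j = δ-shift i≤p j

  sum-δ : ∀ (g : ℕ → ℚ) {p N} → p ℕ.< N → sum {N} (λ i → g (toℕ i) * δ p (toℕ i)) ≡ g p
  sum-δ g {zero}  {suc N} _ = trans
    (cong (_+_ (g 0 * 1ℚ)) (sum-zero N {λ k → g (suc k) * 0ℚ} (λ k _ → *-zeroʳ (g (suc k)))))
    (trans (+-identityʳ _) (*-identityʳ (g 0)))
  sum-δ g {suc p} {suc N} (s≤s p<N) = trans
    (cong₂ _+_ (*-zeroʳ (g 0)) (sum-δ (g ∘ suc) p<N)) (+-identityˡ _)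

  -- The left side is the coefficient of t^p in (t + a)^n t^i, and the factor t^i moves coefficients
  -- up by `i`.
  E+^-δ : ∀ a n {p i} → i ℕ.≤ p → E+^ a n (δ p) i ≡ binom a n (p ∸ i)
  E+^-δ a n {p} {i} i≤p = begin
    E+^ a n (δ p) i                                              ≡⟨ E+^-expansion a (δ p) n N (s≤s (ℕ.m≤m+n n p)) i ⟩
    sum {N} (λ j → binom a n (toℕ j) * δ p (i ℕ.+ toℕ j))        ≡⟨ sum-cong N (λ k _ → cong (binom a n k *_) (δ-shift i≤p k)) ⟩
    sum {N} (λ j → binom a n (toℕ j) * δ (p ∸ i) (toℕ j))        ≡⟨ sum-δ (binom a n) (s≤s (ℕ.≤-trans (ℕ.m∸n≤m p i) (ℕ.m≤n+m p n))) ⟩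
    binom a n (p ∸ i)                                            ∎
    -- Long enough for both uses: above `n` for the expansion, above `p ∸ i` for selecting one term.
    where N = suc (n ℕ.+ p)

  -- Both sides are the coefficient of tⁿ in (t + a)ⁿ (t + b)ⁿ = ((t + h)² + c)ⁿ.
  -- Instead of multiplying polynomials by t, the proof applies the transpose of
  -- that operation, the shift of sequences, to the functional δ n reading off tⁿ.
  module _ {a b h c : ℚ} (sum-eq : a + b ≡ h + h) (prod-eq : a * b ≡ h * h + c) where

    product-expansion : ∀ n →
      sum {suc n} (λ i → binom a n (toℕ i) * binom b n (n ∸ toℕ i)) ≡
      sum {suc n} (λ i → binom c n (toℕ i) * binom h (2 ℕ.* toℕ i) n)
    product-expansion n = begin
      sum {suc n} (λ i → binom a n (toℕ i) * binom b n (n ∸ toℕ i))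
        ≡⟨ sum-cong (suc n) (λ { k (s≤s k≤n) → cong (binom a n k *_) (sym (E+^-δ b n k≤n)) }) ⟩
      sum {suc n} (λ i → binom a n (toℕ i) * E+^ b n (δ n) (toℕ i))
        ≡⟨ E+^-expansion a (E+^ b n (δ n)) n (suc n) ℕ.≤-refl 0 ⟨
      E+^ a n (E+^ b n (δ n)) 0
        ≡⟨ L≗U n 0 ⟩
      U n 0 0
        ≡⟨ binomial-expansion c (λ n j → U n j 0) (λ _ _ → refl) n (suc n) ℕ.≤-refl 0 ⟩
      sum {suc n} (λ i → binom c n (toℕ i) * E+^ h (2 ℕ.* toℕ i) (δ n) 0)
        ≡⟨ sum-cong (suc n) (λ k _ → cong (binom c n k *_) (E+^-δ h (2 ℕ.* k) {n} {0} z≤n)) ⟩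
      sum {suc n} (λ i → binom c n (toℕ i) * binom h (2 ℕ.* toℕ i) n) ∎
      where
      open +-*-Solver
      -- `U k j m` is the coefficient of tⁿ in ((t + h)² + c)^k (t + h)^(2j) t^m. The index `j`
      -- makes multiplication by (t + h)² a shift, so `binomial-expansion` applies again, this time
      -- along `j`.
      U : ℕ → ℕ → ℕ → ℚ
      U zero    j m = E+^ h (2 ℕ.* j) (δ n) m
      U (suc k) j m = U k (suc j) m + c * U k j m

      U-suc : ∀ k j → U k (suc j) ≗ E+ h (E+ h (U k j))
      U-suc zero    j m = cong (λ i → E+ h (E+^ h i (δ n)) m) (ℕ.+-suc j (j ℕ.+ 0))
      U-suc (suc k) j m = trans
        (cong₂ (λ u v → u + c * v) (U-suc k (suc j) m) (U-suc k j m))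
        (solve 8 (λ h c u v w x y z →
           (w :+ h :* v :+ h :* (v :+ h :* u)) :+ c :* (z :+ h :* y :+ h :* (y :+ h :* x)) :=
           (w :+ c :* z) :+ h :* (v :+ c :* y) :+ h :* ((v :+ c :* y) :+ h :* (u :+ c :* x)))
         refl h c (U k (suc j) m) (U k (suc j) (suc m)) (U k (suc j) (suc (suc m)))
         (U k j m) (U k j (suc m)) (U k j (suc (suc m))))

      -- The dual form of (t + a)(t + b) = (t + h)² + c, which is what `sum-eq` and `prod-eq` amount
      -- to.
      factor : ∀ s → E+ a (E+ b s) ≗ λ m → E+ h (E+ h s) m + c * s m
      factor s m = begin
        (w + b * v) + a * (v + b * u)      ≡⟨ solve 5 (λ a b u v w → (w :+ b :* v) :+ a :* (v :+ b :* u) :=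
                                                w :+ (a :+ b) :* v :+ (a :* b) :* u) refl a b u v w ⟩
        w + (a + b) * v + (a * b) * u      ≡⟨ cong₂ (λ p q → w + p * v + q * u) sum-eq prod-eq ⟩
        w + (h + h) * v + (h * h + c) * u  ≡⟨ solve 5 (λ h c u v w → w :+ (h :+ h) :* v :+ (h :* h :+ c) :* u :=
                                                (w :+ h :* v) :+ h :* (v :+ h :* u) :+ c :* u) refl h c u v w ⟩
        (w + h * v) + h * (v + h * u) + c * u ∎
        where u = s m ; v = s (suc m) ; w = s (suc (suc m))

      L≗U : ∀ k → E+^ a k (E+^ b k (δ n)) ≗ U k 0
      L≗U zero    m = refl
      L≗U (suc k) m = begin
        E+ a (E+^ a k (E+ b (E+^ b k (δ n)))) m   ≡⟨ E+-cong a (E+^-comm a b k _) m ⟩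
        E+ a (E+ b (E+^ a k (E+^ b k (δ n)))) m   ≡⟨ E+-cong a (E+-cong b (L≗U k)) m ⟩
        E+ a (E+ b (U k 0)) m                     ≡⟨ factor (U k 0) m ⟩
        E+ h (E+ h (U k 0)) m + c * U k 0 m       ≡⟨ cong (_+ c * U k 0 m) (sym (U-suc k 0 m)) ⟩
        U k 1 m + c * U k 0 m                     ∎

  -- The Legendre polynomial as a sum with squared binomial coefficients.

  C-! : ∀ a b → ((a ℕ.+ b) C a) ℕ.* (a ! ℕ.* b !) ≡ (a ℕ.+ b) !
  C-! a b = begin
    (n C a) ℕ.* (a ! ℕ.* b !)         ≡⟨ cong (λ j → (n C a) ℕ.* (a ! ℕ.* j !)) (ℕ.m+n∸m≡n a b) ⟨
    (n C a) ℕ.* (a ! ℕ.* (n ∸ a) !)   ≡⟨ cong (ℕ._* (a ! ℕ.* (n ∸ a) !)) (nCk≡n!/k![n-k]! a≤n) ⟩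
    _                               ≡⟨ ℕ.m/n*n≡m (k![n∸k]!∣n! a≤n) ⟩
    n !                             ∎
    where
    n = a ℕ.+ b
    a≤n = ℕ.m≤m+n a b
    instance _ = a ℕ.!* (n ∸ a) !≢0

  -- Writing n as 2k + r turns both n - 2k and 2(n - k) - n into `r`, which removes the truncated
  -- subtractions.
  halve : ∀ n {k} → k ℕ.≤ ⌊ n /2⌋ → ∃[ r ] n ≡ k ℕ.+ (k ℕ.+ r)
  halve n             {zero}  _         = n , refl
  halve (suc (suc n)) {suc k} (s≤s k≤) with halve n k≤
  ... | r , refl = r , cong suc (sym (ℕ.+-suc k (k ℕ.+ r)))

  -- Past the middle, (t + h)^(2(n - k)) has degree below n and contributes nothing to tⁿ; this is
  -- why the Legendre sum can stop at `⌊ n /2⌋`.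
  2[n∸k]<n : ∀ {n k} → ⌊ n /2⌋ ℕ.< k → k ℕ.≤ n → 2 ℕ.* (n ∸ k) ℕ.< n
  2[n∸k]<n {n} {k} n/2<k k≤n = ≤.begin-strict
    j ℕ.+ (j ℕ.+ 0)   ≤.≡⟨ cong (j ℕ.+_) (ℕ.+-identityʳ j) ⟩
    j ℕ.+ j           ≤.<⟨ ℕ.+-monoʳ-< j (ℕ.≰⇒> k≰j) ⟩
    j ℕ.+ k           ≤.≡⟨ ℕ.m∸n+n≡m k≤n ⟩
    n                 ≤.∎
    where
    module ≤ = ℕ.≤-Reasoning
    j = n ∸ k
    k≰j : ¬ k ℕ.≤ j
    k≰j k≤j = ℕ.<⇒≱ n/2<k (subst (ℕ._≤ ⌊ n /2⌋) (sym (ℕ.n≡⌊n+n/2⌋ k))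
      (ℕ.⌊n/2⌋-mono (subst (k ℕ.+ k ℕ.≤_) (ℕ.m+[n∸m]≡n k≤n) (ℕ.+-monoʳ-≤ k k≤j))))

  -- Both products are the trinomial coefficient (2m)!/(k! m! r!), whose denominator is `D`. The
  -- left one arises from expanding the power, the right one from the Legendre formula.
  C-trinomial : ∀ k r → let m = k ℕ.+ r ; n = k ℕ.+ m in
    (n C k) ℕ.* ((m ℕ.+ m) C n) ≡ (m C k) ℕ.* ((m ℕ.+ m) C m)
  C-trinomial k r = ℕ.*-cancelʳ-≡ _ _ D {{D≢0}} (begin
    A ℕ.* B ℕ.* D                                  ≡⟨ solve 5 (λ a b x y z → a :* b :* (x :* y :* z) := b :* ((a :* (x :* y)) :* z)) refl A B (k !) (m !) (r !) ⟩
    B ℕ.* (A ℕ.* (k ! ℕ.* m !) ℕ.* r !)            ≡⟨ cong (λ t → B ℕ.* (t ℕ.* r !)) (C-! k m) ⟩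
    B ℕ.* (n ! ℕ.* r !)                            ≡⟨ cong (λ t → (t C n) ℕ.* (n ! ℕ.* r !)) m+m≡n+r ⟩
    ((n ℕ.+ r) C n) ℕ.* (n ! ℕ.* r !)              ≡⟨ C-! n r ⟩
    (n ℕ.+ r) !                                    ≡⟨ cong _! m+m≡n+r ⟨
    (m ℕ.+ m) !                                    ≡⟨ C-! m m ⟨
    G ℕ.* (m ! ℕ.* m !)                            ≡⟨ cong (λ t → G ℕ.* (t ℕ.* m !)) (C-! k r) ⟨
    G ℕ.* (F ℕ.* (k ! ℕ.* r !) ℕ.* m !)            ≡⟨ solve 5 (λ f g x y z → g :* ((f :* (x :* z)) :* y) := f :* g :* (x :* y :* z)) refl F G (k !) (m !) (r !) ⟩
    F ℕ.* G ℕ.* D                                  ∎)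
    where
    open ℕ-Solver.+-*-Solver
    m = k ℕ.+ r
    n = k ℕ.+ m
    A = n C k
    B = (m ℕ.+ m) C n
    F = m C k
    G = (m ℕ.+ m) C m
    D = k ! ℕ.* m ! ℕ.* r !
    D≢0 = ℕ.m*n≢0 (k ! ℕ.* m !) (r !) {{ℕ.m*n≢0 (k !) (m !) {{k ℕ.!≢0}} {{m ℕ.!≢0}}}} {{r ℕ.!≢0}}
    m+m≡n+r : m ℕ.+ m ≡ n ℕ.+ r
    m+m≡n+r = solve 2 (λ k r → (k :+ r) :+ (k :+ r) := (k :+ (k :+ r)) :+ r) refl k r

  legendre : ℕ → ℚ → ℚ
  legendre n x = ½ ^ n * sum {suc ⌊ n /2⌋} λ i → let k = toℕ i in
    (- 1ℚ) ^ k * ι (((n ∸ k) C k) ℕ.* ((2 ℕ.* n ∸ 2 ℕ.* k) C (n ∸ k))) * x ^ (n ∸ 2 ℕ.* k)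

  centralSum : ℕ → ℚ → ℚ
  centralSum n y = sum {suc n} λ i → let k = toℕ i in
    ι ((n C k) ℕ.* (n C k)) * (y ^ k * (y - 1ℚ) ^ (n ∸ k))

  legendre-centralSum : ∀ n y → legendre n (ι 2 * y - 1ℚ) ≡ centralSum n y
  legendre-centralSum n y = begin
    ½ ^ n * sum {suc ⌊ n /2⌋} (term ∘ toℕ)
      ≡⟨ *-distribˡ-sum {suc ⌊ n /2⌋} (½ ^ n) (term ∘ toℕ) ⟩
    sum {suc ⌊ n /2⌋} (λ i → ½ ^ n * term (toℕ i))
      ≡⟨ sum-extend (s≤s (ℕ.⌊n/2⌋≤n n)) match vanish ⟩
    sum {suc n} (λ i → binom c n (n ∸ toℕ i) * binom h (2 ℕ.* (n ∸ toℕ i)) n)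
      -- The Legendre index counts factors c = -1/4, the expansion index counts factors (t + h)², so
      -- one of the sums runs backwards.
      ≡⟨ sum-reverse n (λ k → binom c n k * binom h (2 ℕ.* k) n) ⟨
    sum {suc n} (λ i → binom c n (toℕ i) * binom h (2 ℕ.* toℕ i) n)
      ≡⟨ product-expansion {y - 1ℚ} {y} {h} {c}
           (solve 1 (λ y → (y :- con 1ℚ) :+ y := con ½ :* (con (ι 2) :* y :- con 1ℚ) :+ con ½ :* (con (ι 2) :* y :- con 1ℚ)) refl y)
           (solve 1 (λ y → (y :- con 1ℚ) :* y :=
              (con ½ :* (con (ι 2) :* y :- con 1ℚ)) :* (con ½ :* (con (ι 2) :* y :- con 1ℚ)) :+ con c) refl y) n ⟨
    sum {suc n} (λ i → binom (y - 1ℚ) n (toℕ i) * binom y n (n ∸ toℕ i))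
      ≡⟨ sum-cong (suc n) (λ { k (s≤s k≤n) → merge k≤n }) ⟩
    centralSum n y ∎
    where
    open +-*-Solver
    x = ι 2 * y - 1ℚ
    h = ½ * x
    c = - 1ℚ * (½ * ½)
    term : ℕ → ℚ
    term k = (- 1ℚ) ^ k * ι (((n ∸ k) C k) ℕ.* ((2 ℕ.* n ∸ 2 ℕ.* k) C (n ∸ k))) * x ^ (n ∸ 2 ℕ.* k)

    merge : ∀ {k} → k ℕ.≤ n → binom (y - 1ℚ) n k * binom y n (n ∸ k) ≡
      ι ((n C k) ℕ.* (n C k)) * (y ^ k * (y - 1ℚ) ^ (n ∸ k))
    merge {k} k≤n = begin
      ι (n C k) * w * (ι (n C (n ∸ k)) * y ^ (n ∸ (n ∸ k)))
        ≡⟨ cong₂ (λ s t → ι (n C k) * w * (ι s * y ^ t)) (sym (nCk≡nC[n∸k] k≤n)) (ℕ.m∸[m∸n]≡n k≤n) ⟩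
      ι (n C k) * w * (ι (n C k) * y ^ k)
        ≡⟨ solve 3 (λ a w v → a :* w :* (a :* v) := a :* a :* (v :* w)) refl (ι (n C k)) w (y ^ k) ⟩
      ι (n C k) * ι (n C k) * (y ^ k * w)
        ≡⟨ cong (_* (y ^ k * w)) (ι-* (n C k) (n C k)) ⟨
      ι ((n C k) ℕ.* (n C k)) * (y ^ k * w) ∎
      where w = (y - 1ℚ) ^ (n ∸ k)

    vanish : ∀ k → suc ⌊ n /2⌋ ℕ.≤ k → k ℕ.< suc n →
      binom c n (n ∸ k) * binom h (2 ℕ.* (n ∸ k)) n ≡ 0ℚ
    vanish k n/2<k (s≤s k≤n) =
      trans (cong (binom c n (n ∸ k) *_) (binom-vanish h (2[n∸k]<n n/2<k k≤n))) (*-zeroʳ (binom c n (n ∸ k)))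

    -- Of the n = 2k + r factors ½, the first 2k join (-1)^k to form (-1/4)^k and the other r turn
    -- x^r into h^r.
    match : ∀ k → k ℕ.< suc ⌊ n /2⌋ →
      ½ ^ n * term k ≡ binom c n (n ∸ k) * binom h (2 ℕ.* (n ∸ k)) n
    match k (s≤s k≤n/2) = from-halves (halve n k≤n/2)
      where
      from-halves : ∃[ r ] n ≡ k ℕ.+ (k ℕ.+ r) →
        ½ ^ n * term k ≡ binom c n (n ∸ k) * binom h (2 ℕ.* (n ∸ k)) n
      from-halves (r , n≡) = begin
        ½ ^ n * ((- 1ℚ) ^ k * ι (((n ∸ k) C k) ℕ.* ((2 ℕ.* n ∸ 2 ℕ.* k) C (n ∸ k))) * x ^ (n ∸ 2 ℕ.* k))
          ≡⟨ cong₂ (λ s t → ½ ^ s * ((- 1ℚ) ^ k * ι t * x ^ (n ∸ 2 ℕ.* k))) n≡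
               (trans (cong₂ (λ s t → (s C k) ℕ.* (t C s)) n∸k≡m 2n∸2k≡m+m) (sym (C-trinomial k r))) ⟩
        ½ ^ (k ℕ.+ m) * ((- 1ℚ) ^ k * ι (A ℕ.* B) * x ^ (n ∸ 2 ℕ.* k))
          ≡⟨ cong₂ (λ s t → s * ((- 1ℚ) ^ k * t * x ^ (n ∸ 2 ℕ.* k)))
               (trans (^-homo-* ½ k m) (cong (½ ^ k *_) (^-homo-* ½ k r))) (ι-* A B) ⟩
        ½ ^ k * (½ ^ k * ½ ^ r) * ((- 1ℚ) ^ k * (ι A * ι B) * x ^ (n ∸ 2 ℕ.* k))
          ≡⟨ cong (λ t → ½ ^ k * (½ ^ k * ½ ^ r) * ((- 1ℚ) ^ k * (ι A * ι B) * x ^ t)) n∸2k≡r ⟩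
        ½ ^ k * (½ ^ k * ½ ^ r) * ((- 1ℚ) ^ k * (ι A * ι B) * x ^ r)
          ≡⟨ solve 6 (λ p q s a b u → p :* (p :* q) :* (s :* (a :* b) :* u) := a :* (s :* (p :* p)) :* (b :* (q :* u)))
               refl (½ ^ k) (½ ^ r) ((- 1ℚ) ^ k) (ι A) (ι B) (x ^ r) ⟩
        ι A * ((- 1ℚ) ^ k * (½ ^ k * ½ ^ k)) * (ι B * (½ ^ r * x ^ r))
          ≡⟨ cong₂ (λ s t → ι A * s * (ι B * t))
               (trans (cong ((- 1ℚ) ^ k *_) (sym (^-distrib-* ½ ½ k))) (sym (^-distrib-* (- 1ℚ) (½ * ½) k)))
               (sym (^-distrib-* ½ x r)) ⟩
        ι A * c ^ k * (ι B * h ^ r)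
          ≡⟨ cong₂ (λ s t → ι s * c ^ k * (ι t * h ^ r))
               (trans (cong (_C k) (sym n≡)) (nCk≡nC[n∸k] k≤n))
               (cong₂ _C_ (sym 2[n∸k]≡m+m) (sym n≡)) ⟩
        ι (n C (n ∸ k)) * c ^ k * (ι ((2 ℕ.* (n ∸ k)) C n) * h ^ r)
          ≡⟨ cong₂ (λ s t → ι (n C (n ∸ k)) * c ^ s * (ι ((2 ℕ.* (n ∸ k)) C n) * h ^ t))
               (sym (ℕ.m∸[m∸n]≡n k≤n)) (sym 2[n∸k]∸n≡r) ⟩
        binom c n (n ∸ k) * binom h (2 ℕ.* (n ∸ k)) n ∎
        where
        m = k ℕ.+ r
        A = (k ℕ.+ m) C k
        B = (m ℕ.+ m) C (k ℕ.+ m)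
        k≤n = ℕ.≤-trans k≤n/2 (ℕ.⌊n/2⌋≤n n)
        n∸k≡m : n ∸ k ≡ m
        n∸k≡m = trans (cong (_∸ k) n≡) (ℕ.m+n∸m≡n k m)
        2[n∸k]≡m+m : 2 ℕ.* (n ∸ k) ≡ m ℕ.+ m
        2[n∸k]≡m+m = cong₂ (λ s t → s ℕ.+ t) n∸k≡m (trans (ℕ.+-identityʳ (n ∸ k)) n∸k≡m)
        2n∸2k≡m+m : 2 ℕ.* n ∸ 2 ℕ.* k ≡ m ℕ.+ m
        2n∸2k≡m+m = trans (sym (ℕ.*-distribˡ-∸ 2 n k)) 2[n∸k]≡m+m
        n∸2k≡r : n ∸ 2 ℕ.* k ≡ r
        n∸2k≡r = trans (sym (ℕ.∸-+-assoc n k (k ℕ.+ 0)))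
          (trans (cong₂ _∸_ n∸k≡m (ℕ.+-identityʳ k)) (ℕ.m+n∸m≡n k r))
        2[n∸k]∸n≡r : 2 ℕ.* (n ∸ k) ∸ n ≡ r
        2[n∸k]∸n≡r = trans (cong₂ _∸_ 2[n∸k]≡m+m (trans n≡ (ℕ.+-comm k m)))
          (trans (ℕ.[m+n]∸[m+o]≡n∸o m m k) (ℕ.m+n∸m≡n k r))

  -- Narayana coefficients and the antiderivative.

  -- For k < n both sides are n!/(k! (n - k - 1)!). It converts the mixed products C(n,k) C(n,k+1)
  -- in the Narayana coefficients into squares.
  C-absorb : ∀ n k → (n ∸ k) ℕ.* (n C k) ≡ suc k ℕ.* (n C suc k)
  C-absorb n k with n ℕ.≤? k
  ... | yes n≤k = begin
    (n ∸ k) ℕ.* (n C k)      ≡⟨ cong (ℕ._* (n C k)) (ℕ.m≤n⇒m∸n≡0 n≤k) ⟩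
    0                        ≡⟨ ℕ.*-zeroʳ (suc k) ⟨
    suc k ℕ.* 0              ≡⟨ cong (suc k ℕ.*_) (k>n⇒nCk≡0 (s≤s n≤k)) ⟨
    suc k ℕ.* (n C suc k)    ∎
  ... | no n≰k = ℕ.*-cancelʳ-≡ _ _ (k ! ℕ.* b !) {{ℕ.m*n≢0 (k !) (b !) {{k ℕ.!≢0}} {{b ℕ.!≢0}}}} (begin
    (n ∸ k) ℕ.* (n C k) ℕ.* (k ! ℕ.* b !)       ≡⟨ cong (λ t → t ℕ.* (n C k) ℕ.* (k ! ℕ.* b !)) n∸k≡1+b ⟩
    suc b ℕ.* (n C k) ℕ.* (k ! ℕ.* b !)         ≡⟨ solve 4 (λ s c x y → s :* c :* (x :* y) := c :* (x :* (s :* y))) refl (suc b) (n C k) (k !) (b !) ⟩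
    (n C k) ℕ.* (k ! ℕ.* suc b !)               ≡⟨ cong (λ t → (t C k) ℕ.* (k ! ℕ.* suc b !)) n≡k+1+b ⟩
    ((k ℕ.+ suc b) C k) ℕ.* (k ! ℕ.* suc b !)   ≡⟨ C-! k (suc b) ⟩
    (k ℕ.+ suc b) !                             ≡⟨ cong _! (ℕ.+-suc k b) ⟩
    (suc k ℕ.+ b) !                             ≡⟨ C-! (suc k) b ⟨
    ((suc k ℕ.+ b) C suc k) ℕ.* (suc k ! ℕ.* b !) ≡⟨ cong (λ t → (t C suc k) ℕ.* (suc k ! ℕ.* b !)) (trans n≡k+1+b (ℕ.+-suc k b)) ⟨
    (n C suc k) ℕ.* (suc k ! ℕ.* b !)           ≡⟨ solve 4 (λ s c x y → c :* ((s :* x) :* y) := s :* c :* (x :* y)) refl (suc k) (n C suc k) (k !) (b !) ⟩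
    suc k ℕ.* (n C suc k) ℕ.* (k ! ℕ.* b !)     ∎)
    where
    open ℕ-Solver.+-*-Solver
    k<n = ℕ.≰⇒> n≰k
    b = n ∸ suc k
    n∸k≡1+b : n ∸ k ≡ suc b
    n∸k≡1+b = ℕ.+-∸-assoc 1 k<n
    n≡k+1+b : n ≡ k ℕ.+ suc b
    n≡k+1+b = trans (sym (ℕ.m+[n∸m]≡n (ℕ.<⇒≤ k<n))) (cong (k ℕ.+_) n∸k≡1+b)

  *ι-cancel : ∀ n .{{_ : ℕ.NonZero n}} {p q} → p * ι n ≡ q * ι n → p ≡ q
  *ι-cancel n {p} {q} eq = begin
    p                        ≡⟨ expand p ⟩
    p * ι n * (+ 1 / n)      ≡⟨ cong (_* (+ 1 / n)) eq ⟩
    q * ι n * (+ 1 / n)      ≡⟨ expand q ⟨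
    q                        ∎
    where
    expand : ∀ p → p ≡ p * ι n * (+ 1 / n)
    expand p = begin
      p                      ≡⟨ *-identityʳ p ⟨
      p * 1ℚ                 ≡⟨ cong (p *_) (/-*-cancel 1 n) ⟨
      p * ((+ 1 / n) * ι n)  ≡⟨ cong (p *_) (*-comm (+ 1 / n) (ι n)) ⟩
      p * (ι n * (+ 1 / n))  ≡⟨ *-assoc p (ι n) (+ 1 / n) ⟨
      p * ι n * (+ 1 / n)    ∎

  module _ (n : ℕ) .{{_ : ℕ.NonZero n}} where

    ν : ℕ → ℚ
    ν k = + ((n C k) ℕ.* (n C suc k)) / n

    narayana : ℚ → ℚ
    narayana q = sum {n} λ i → ν (toℕ i) * q ^ suc (toℕ i)

    -- With F the case z = 1, this is F(z x)/z after cancelling one `z`: the bare `x` is what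
    -- remains of the first of the k + 1 factors z x.
    antideriv : ℚ → ℚ → ℚ
    antideriv z x = sum {n} λ i → let k = toℕ i in
      ν k * (x * (z * x) ^ k * (z * x - 1ℚ) ^ (n ∸ k))

    -- After multiplication by n, absorption turns the two parts of a summand into squared
    -- binomials, weighted by n - k at index k and by k + 1 at index k + 1. Each index k thus
    -- collects the weights n - k and k from neighbouring summands, and these add up to n.
    antideriv-derivative-sum : ∀ y →
      sum {n} (λ i → let k = toℕ i in
        ν k * (ι (suc k) * (y ^ k * (y - 1ℚ) ^ (n ∸ k))
               + ι (n ∸ k) * (y ^ suc k * (y - 1ℚ) ^ (n ∸ suc k))))
      ≡ centralSum n y
    antideriv-derivative-sum y = *ι-cancel n (begin
      sum {n} (T ∘ toℕ) * ι n
        ≡⟨ *-distribʳ-sum {n} (ι n) (T ∘ toℕ) ⟩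
      sum {n} (λ i → T (toℕ i) * ι n)
        ≡⟨ sum-cong n (λ k _ → split k) ⟩
      sum {n} (λ i → g (toℕ i) + h (suc (toℕ i)))
        ≡⟨ ∑-distrib-+ {n} (g ∘ toℕ) (h ∘ suc ∘ toℕ) ⟩
      sum {n} (g ∘ toℕ) + sum {n} (h ∘ suc ∘ toℕ)
        -- Since `g n` and `h 0` are zero, both ranges extend to all indices from 0 to n.
        ≡⟨ cong₂ _+_ (trans (sym (+-identityʳ (sum {n} (g ∘ toℕ)))) (cong (_+_ (sum {n} (g ∘ toℕ))) (sym g-n)))
                     (trans (sym (+-identityˡ (sum {n} (h ∘ suc ∘ toℕ)))) (cong (_+ sum {n} (h ∘ suc ∘ toℕ)) (sym (*-zeroˡ (A 0))))) ⟩
      (sum {n} (g ∘ toℕ) + g n) + sum {suc n} (h ∘ toℕ)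
        ≡⟨ cong (_+ sum {suc n} (h ∘ toℕ)) (sum-last n g) ⟨
      sum {suc n} (g ∘ toℕ) + sum {suc n} (h ∘ toℕ)
        ≡⟨ ∑-distrib-+ {suc n} (g ∘ toℕ) (h ∘ toℕ) ⟨
      sum {suc n} (λ i → g (toℕ i) + h (toℕ i))
        ≡⟨ sum-cong (suc n) (λ { k (s≤s k≤n) → merge k≤n }) ⟩
      sum {suc n} (λ i → S (toℕ i) * ι n)
        ≡⟨ *-distribʳ-sum {suc n} (ι n) (S ∘ toℕ) ⟨
      centralSum n y * ι n ∎)
      where
      open +-*-Solver
      A g h S T : ℕ → ℚ
      A k = y ^ k * (y - 1ℚ) ^ (n ∸ k)
      T k = ν k * (ι (suc k) * A k + ι (n ∸ k) * A (suc k))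
      g k = ι ((n ∸ k) ℕ.* ((n C k) ℕ.* (n C k))) * A k
      h k = ι (k ℕ.* ((n C k) ℕ.* (n C k))) * A k
      S k = ι ((n C k) ℕ.* (n C k)) * A k

      g-n : g n ≡ 0ℚ
      g-n = trans (cong (λ t → ι (t ℕ.* ((n C n) ℕ.* (n C n))) * A n) (ℕ.n∸n≡0 n)) (*-zeroˡ (A n))

      split : ∀ k → T k * ι n ≡ g k + h (suc k)
      split k = begin
        ν k * (ι (suc k) * A k + ι (n ∸ k) * A (suc k)) * ι n
          ≡⟨ solve 6 (λ v s t a b m → v :* (s :* a :+ t :* b) :* m := (v :* m) :* s :* a :+ (v :* m) :* t :* b)
               refl (ν k) (ι (suc k)) (ι (n ∸ k)) (A k) (A (suc k)) (ι n) ⟩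
        ν k * ι n * ι (suc k) * A k + ν k * ι n * ι (n ∸ k) * A (suc k)
          ≡⟨ cong (λ t → t * ι (suc k) * A k + t * ι (n ∸ k) * A (suc k)) (/-*-cancel (c ℕ.* c′) n) ⟩
        ι (c ℕ.* c′) * ι (suc k) * A k + ι (c ℕ.* c′) * ι (n ∸ k) * A (suc k)
          ≡⟨ cong₂ (λ s t → s * A k + t * A (suc k)) (sym (ι-* (c ℕ.* c′) (suc k))) (sym (ι-* (c ℕ.* c′) (n ∸ k))) ⟩
        ι (c ℕ.* c′ ℕ.* suc k) * A k + ι (c ℕ.* c′ ℕ.* (n ∸ k)) * A (suc k)
          ≡⟨ cong₂ (λ s t → ι s * A k + ι t * A (suc k)) left right ⟩
        g k + h (suc k) ∎
        where
        module ℕS = ℕ-Solver.+-*-Solver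
        c = n C k
        c′ = n C suc k
        left : c ℕ.* c′ ℕ.* suc k ≡ (n ∸ k) ℕ.* (c ℕ.* c)
        left = begin
          c ℕ.* c′ ℕ.* suc k         ≡⟨ ℕS.solve 3 (λ a b s → a ℕS.:* b ℕS.:* s ℕS.:= (s ℕS.:* b) ℕS.:* a) refl c c′ (suc k) ⟩
          suc k ℕ.* c′ ℕ.* c         ≡⟨ cong (ℕ._* c) (C-absorb n k) ⟨
          (n ∸ k) ℕ.* c ℕ.* c        ≡⟨ ℕ.*-assoc (n ∸ k) c c ⟩
          (n ∸ k) ℕ.* (c ℕ.* c)      ∎
        right : c ℕ.* c′ ℕ.* (n ∸ k) ≡ suc k ℕ.* (c′ ℕ.* c′)
        right = begin
          c ℕ.* c′ ℕ.* (n ∸ k)       ≡⟨ ℕS.solve 3 (λ a b s → a ℕS.:* b ℕS.:* s ℕS.:= (s ℕS.:* a) ℕS.:* b) refl c c′ (n ∸ k) ⟩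
          (n ∸ k) ℕ.* c ℕ.* c′       ≡⟨ cong (ℕ._* c′) (C-absorb n k) ⟩
          suc k ℕ.* c′ ℕ.* c′        ≡⟨ ℕ.*-assoc (suc k) c′ c′ ⟩
          suc k ℕ.* (c′ ℕ.* c′)      ∎

      merge : ∀ {k} → k ℕ.≤ n → g k + h k ≡ S k * ι n
      merge {k} k≤n = begin
        ι ((n ∸ k) ℕ.* d) * A k + ι (k ℕ.* d) * A k  ≡⟨ *-distribʳ-+ (A k) (ι ((n ∸ k) ℕ.* d)) (ι (k ℕ.* d)) ⟨
        (ι ((n ∸ k) ℕ.* d) + ι (k ℕ.* d)) * A k      ≡⟨ cong (_* A k) (ι-+ ((n ∸ k) ℕ.* d) (k ℕ.* d)) ⟨
        ι ((n ∸ k) ℕ.* d ℕ.+ k ℕ.* d) * A k          ≡⟨ cong (λ t → ι t * A k) (ℕ.*-distribʳ-+ d (n ∸ k) k) ⟨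
        ι ((n ∸ k ℕ.+ k) ℕ.* d) * A k                ≡⟨ cong (λ t → ι (t ℕ.* d) * A k) (ℕ.m∸n+n≡m k≤n) ⟩
        ι (n ℕ.* d) * A k                            ≡⟨ cong (_* A k) (ι-* n d) ⟩
        ι n * ι d * A k                              ≡⟨ solve 3 (λ m d a → m :* d :* a := d :* a :* m) refl (ι n) (ι d) (A k) ⟩
        ι d * A k * ι n                              ∎
        where d = (n C k) ℕ.* (n C k)

    -- The two argument pairs have the same product z x; only the bare factor `x` differs.
    antideriv-rescale : ∀ y → antideriv 1ℚ y ≡ y * antideriv y 1ℚ
    antideriv-rescale y = sym (begin
      y * sum {n} (λ i → term (toℕ i))       ≡⟨ *-distribˡ-sum {n} y (term ∘ toℕ) ⟩
      sum {n} (λ i → y * term (toℕ i))       ≡⟨ sum-cong n (λ k _ → each k) ⟩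
      antideriv 1ℚ y                         ∎)
      where
      open +-*-Solver
      term : ℕ → ℚ
      term k = ν k * (1ℚ * (y * 1ℚ) ^ k * (y * 1ℚ - 1ℚ) ^ (n ∸ k))
      each : ∀ k → y * term k ≡ ν k * (y * (1ℚ * y) ^ k * (1ℚ * y - 1ℚ) ^ (n ∸ k))
      each k = begin
        y * (ν k * (1ℚ * (y * 1ℚ) ^ k * (y * 1ℚ - 1ℚ) ^ (n ∸ k)))
          ≡⟨ cong (λ t → y * (ν k * (1ℚ * t ^ k * (t - 1ℚ) ^ (n ∸ k)))) (*-comm y 1ℚ) ⟩
        y * (ν k * (1ℚ * (1ℚ * y) ^ k * (1ℚ * y - 1ℚ) ^ (n ∸ k)))
          ≡⟨ solve 4 (λ y v a b → y :* (v :* (con 1ℚ :* a :* b)) := v :* (y :* a :* b)) refl y (ν k) ((1ℚ * y) ^ k) ((1ℚ * y - 1ℚ) ^ (n ∸ k)) ⟩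
        ν k * (y * (1ℚ * y) ^ k * (1ℚ * y - 1ℚ) ^ (n ∸ k)) ∎

    module _ {q r} (r[q-1]≡1 : r * (q - 1ℚ) ≡ 1ℚ) where
      private
        open +-*-Solver
        y = q * r
        d = q - 1ℚ

        y*d≡q : y * d ≡ q
        y*d≡q = trans (*-assoc q r d) (trans (cong (q *_) r[q-1]≡1) (*-identityʳ q))

        [1*y-1]*d≡1 : (1ℚ * y - 1ℚ) * d ≡ 1ℚ
        [1*y-1]*d≡1 = trans
          (solve 2 (λ y q → (con 1ℚ :* y :- con 1ℚ) :* (q :- con 1ℚ) := y :* (q :- con 1ℚ) :+ (con 1ℚ :- q)) refl y q)
          (trans (cong (_+ (1ℚ - q)) y*d≡q) (solve 1 (λ q → q :+ (con 1ℚ :- q) := con 1ℚ) refl q))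

        1^ : ∀ k → 1ℚ ^ k ≡ 1ℚ
        1^ zero    = refl
        1^ (suc k) = trans (*-identityˡ (1ℚ ^ k)) (1^ k)

      narayana-antideriv : narayana q ≡ d ^ suc n * antideriv 1ℚ y
      narayana-antideriv = sym (trans
        (*-distribˡ-sum {n} (d ^ suc n) (λ i → term (toℕ i)))
        (sum-cong n (λ k k<n → each (ℕ.<⇒≤ k<n))))
        where
        term : ℕ → ℚ
        term k = ν k * (y * (1ℚ * y) ^ k * (1ℚ * y - 1ℚ) ^ (n ∸ k))
        each : ∀ {k} → k ℕ.≤ n → d ^ suc n * term k ≡ ν k * q ^ suc k
        each {k} k≤n = begin
          d * d ^ n * (ν k * (y * (1ℚ * y) ^ k * w ^ j))
            ≡⟨ cong₂ (λ s t → d * s * (ν k * (y * t ^ k * w ^ j)))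
                 (trans (cong (d ^_) (sym (ℕ.m+[n∸m]≡n k≤n))) (^-homo-* d k j)) (*-identityˡ y) ⟩
          d * (d ^ k * d ^ j) * (ν k * (y * y ^ k * w ^ j))
            ≡⟨ solve 7 (λ d a b v y u w → d :* (a :* b) :* (v :* (y :* u :* w)) := v :* ((y :* d) :* (u :* a)) :* (w :* b))
                 refl d (d ^ k) (d ^ j) (ν k) y (y ^ k) (w ^ j) ⟩
          ν k * (y * d * (y ^ k * d ^ k)) * (w ^ j * d ^ j)
            ≡⟨ cong₂ (λ s t → ν k * (y * d * s) * t) (sym (^-distrib-* y d k)) (sym (^-distrib-* w d j)) ⟩
          ν k * (y * d * (y * d) ^ k) * (w * d) ^ j
            ≡⟨ cong₂ (λ s t → ν k * (s * s ^ k) * t ^ j) y*d≡q [1*y-1]*d≡1 ⟩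
          ν k * q ^ suc k * 1ℚ ^ j
            ≡⟨ cong (ν k * q ^ suc k *_) (1^ j) ⟩
          ν k * q ^ suc k * 1ℚ
            ≡⟨ *-identityʳ (ν k * q ^ suc k) ⟩
          ν k * q ^ suc k ∎
          where
          j = n ∸ k
          w = 1ℚ * y - 1ℚ

      antideriv-substitution : d ^ suc n * antideriv 1ℚ y ≡ q * d ^ n * antideriv y 1ℚ
      antideriv-substitution = begin
        d * d ^ n * antideriv 1ℚ y             ≡⟨ cong (d * d ^ n *_) (antideriv-rescale y) ⟩
        d * d ^ n * (y * antideriv y 1ℚ)       ≡⟨ solve 4 (λ d e y p → d :* e :* (y :* p) := (y :* d) :* e :* p) refl d (d ^ n) y (antideriv y 1ℚ) ⟩
        y * d * d ^ n * antideriv y 1ℚ         ≡⟨ cong (λ t → t * d ^ n * antideriv y 1ℚ) y*d≡q ⟩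
        q * d ^ n * antideriv y 1ℚ             ∎

-- Divided differences of polynomials and their Lipschitz constants.

module Derivatives where
  open Identities
  open import Data.Rational.Base using (_+_; _*_; _-_; -_; ∣_∣; _≤_)
  open import Data.Rational.Properties hiding (_≤?_)
  open ℚ^
  open ℚΣ using (sum)

  -- Reduces a linear inequality to a ring identity for the solver: add up the available bounds,
  -- then compare differences.
  linear : ∀ {x y a b} → x ≤ y → b - a ≡ y - x → a ≤ b
  linear {x} {y} {a} {b} x≤y eq = begin
    a              ≡⟨ solve 2 (λ x a → a := x :+ (a :- x)) refl x a ⟩
    x + (a - x)    ≤⟨ +-monoˡ-≤ (a - x) x≤y ⟩
    y + (a - x)    ≡⟨ solve 3 (λ x y a → y :+ (a :- x) := (y :- x) :+ a) refl x y a ⟩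
    (y - x) + a    ≡⟨ cong (_+ a) eq ⟨
    (b - a) + a    ≡⟨ solve 2 (λ a b → (b :- a) :+ a := b) refl a b ⟩
    b              ∎
    where
    open +-*-Solver
    open ≤-Reasoning

  ∣∣-least : ∀ {p r} → p ≤ r → - p ≤ r → ∣ p ∣ ≤ r
  ∣∣-least {p} p≤r -p≤r with ∣p∣≡p∨∣p∣≡-p p
  ... | inj₁ eq = subst (_≤ _) (sym eq) p≤r
  ... | inj₂ eq = subst (_≤ _) (sym eq) -p≤r

  p≤∣p∣ : ∀ p → p ≤ ∣ p ∣
  p≤∣p∣ p with ≤-total 0ℚ p
  ... | inj₁ 0≤p = ≤-reflexive (sym (0≤p⇒∣p∣≡p 0≤p))
  ... | inj₂ p≤0 = ≤-trans p≤0 (0≤∣p∣ p)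

  -p≤∣p∣ : ∀ p → - p ≤ ∣ p ∣
  -p≤∣p∣ p = subst (- p ≤_) (∣-p∣≡∣p∣ p) (p≤∣p∣ (- p))

  *-mono-nonNeg : ∀ {a b c d} → 0ℚ ≤ a → a ≤ b → 0ℚ ≤ c → c ≤ d → a * c ≤ b * d
  *-mono-nonNeg {a} {b} {c} {d} 0≤a a≤b 0≤c c≤d = ≤-trans
    (*-monoʳ-≤-nonNeg c {{ℚ.nonNegative 0≤c}} a≤b)
    (*-monoˡ-≤-nonNeg b {{ℚ.nonNegative (≤-trans 0≤a a≤b)}} c≤d)

  0≤* : ∀ {a b} → 0ℚ ≤ a → 0ℚ ≤ b → 0ℚ ≤ a * b
  0≤* {a} {b} 0≤a 0≤b = nonNegative⁻¹ (a * b)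
    {{nonNeg*nonNeg⇒nonNeg a {{ℚ.nonNegative 0≤a}} b {{ℚ.nonNegative 0≤b}}}}

  0≤+ : ∀ {a b} → 0ℚ ≤ a → 0ℚ ≤ b → 0ℚ ≤ a + b
  0≤+ = +-mono-≤

  dist : ℚ → ℚ → ℚ → ℚ → ℚ
  dist u v u′ v′ = ∣ u - u′ ∣ + ∣ v - v′ ∣

  0≤dist : ∀ u v u′ v′ → 0ℚ ≤ dist u v u′ v′
  0≤dist u v u′ v′ = 0≤+ (0≤∣p∣ (u - u′)) (0≤∣p∣ (v - v′))

  -- Boundedness accompanies the Lipschitz estimate because products need both; a single `K` serves
  -- for the two. Only `u` and `v` vary in `lip`, since at a fixed index a whole Riemann sum has the
  -- same `z`, but `K` must be uniform in `z`.
  record TameOn (R : ℚ) (g : ℚ → ℚ → ℚ → ℚ) : Set where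
    field
      K     : ℚ
      0≤K   : 0ℚ ≤ K
      bound : ∀ {z u v} → ∣ z ∣ ≤ R → ∣ u ∣ ≤ R → ∣ v ∣ ≤ R → ∣ g z u v ∣ ≤ K
      lip   : ∀ {z u v u′ v′} → ∣ z ∣ ≤ R → ∣ u ∣ ≤ R → ∣ v ∣ ≤ R → ∣ u′ ∣ ≤ R → ∣ v′ ∣ ≤ R →
              ∣ g z u v - g z u′ v′ ∣ ≤ K * dist u v u′ v′

  Tame : (ℚ → ℚ → ℚ → ℚ) → Set
  Tame g = ∀ R → TameOn R g

  tame-swap : ∀ {g} → Tame g → Tame (λ z u v → g z v u)
  tame-swap T R = record
    { K = K ; 0≤K = 0≤K ; bound = λ z u v → bound z v u
    ; lip = λ {z} {u} {v} {u′} {v′} hz hu hv hu′ hv′ →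
        ≤-trans (lip hz hv hu hv′ hu′) (≤-reflexive (cong (K *_) (+-comm ∣ v - v′ ∣ ∣ u - u′ ∣))) }
    where open TameOn (T R)

  tame-ext : ∀ {g h} → (∀ z u v → g z u v ≡ h z u v) → Tame g → Tame h
  tame-ext g≗h T R = record
    { K = K ; 0≤K = 0≤K
    ; bound = λ {z} {u} {v} hz hu hv → subst (λ t → ∣ t ∣ ≤ K) (g≗h z u v) (bound hz hu hv)
    ; lip = λ {z} {u} {v} {u′} {v′} hz hu hv hu′ hv′ →
        subst (λ t → ∣ t ∣ ≤ K * dist u v u′ v′) (cong₂ _-_ (g≗h z u v) (g≗h z u′ v′)) (lip hz hu hv hu′ hv′) }
    where open TameOn (T R)

  tame-param : ∀ (c : ℚ → ℚ) → (∀ R → ∃[ K ] 0ℚ ≤ K × (∀ {z} → ∣ z ∣ ≤ R → ∣ c z ∣ ≤ K)) →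
    Tame (λ z _ _ → c z)
  tame-param c bounded R with bounded R
  ... | K , 0≤K , bound = record
    { K = K ; 0≤K = 0≤K ; bound = λ hz _ _ → bound hz
    ; lip = λ {z} {u} {v} {u′} {v′} _ _ _ _ _ →
        subst (λ t → ∣ t ∣ ≤ K * dist u v u′ v′) (sym (+-inverseʳ (c z))) (0≤* 0≤K (0≤dist u v u′ v′)) }

  tame-const : ∀ c → Tame (λ _ _ _ → c)
  tame-const c = tame-param (λ _ → c) (λ _ → ∣ c ∣ , 0≤∣p∣ c , λ _ → ≤-refl)

  tame-z : Tame (λ z _ _ → z)
  tame-z = tame-param (λ z → z) (λ R → ∣ R ∣ , 0≤∣p∣ R , λ z≤R → ≤-trans z≤R (p≤∣p∣ R))

  tame-u : Tame (λ _ u _ → u)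
  tame-u R = record
    -- The 1 is the Lipschitz constant of a projection and `∣ R ∣` its bound.
    { K = 1ℚ + ∣ R ∣ ; 0≤K = 0≤1+R
    ; bound = λ _ u≤R _ → ≤-trans (≤-trans u≤R (p≤∣p∣ R)) R≤1+R
    ; lip = λ {z} {u} {v} {u′} {v′} _ _ _ _ _ → begin
        ∣ u - u′ ∣                       ≡⟨ +-identityʳ ∣ u - u′ ∣ ⟨
        ∣ u - u′ ∣ + 0ℚ                  ≤⟨ +-monoʳ-≤ ∣ u - u′ ∣ (0≤∣p∣ (v - v′)) ⟩
        dist u v u′ v′                   ≡⟨ *-identityˡ (dist u v u′ v′) ⟨
        1ℚ * dist u v u′ v′              ≤⟨ *-monoʳ-≤-nonNeg (dist u v u′ v′) {{ℚ.nonNegative (0≤dist u v u′ v′)}} 1≤1+R ⟩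
        (1ℚ + ∣ R ∣) * dist u v u′ v′    ∎ }
    where
    open ≤-Reasoning
    0≤1 = nonNegative⁻¹ 1ℚ
    0≤1+R = 0≤+ 0≤1 (0≤∣p∣ R)
    R≤1+R : ∣ R ∣ ≤ 1ℚ + ∣ R ∣
    R≤1+R = subst (_≤ 1ℚ + ∣ R ∣) (+-identityˡ ∣ R ∣) (+-monoˡ-≤ ∣ R ∣ 0≤1)
    1≤1+R : 1ℚ ≤ 1ℚ + ∣ R ∣
    1≤1+R = subst (_≤ 1ℚ + ∣ R ∣) (+-identityʳ 1ℚ) (+-monoʳ-≤ 1ℚ (0≤∣p∣ R))

  tame-+ : ∀ {g h} → Tame g → Tame h → Tame (λ z u v → g z u v + h z u v)
  tame-+ {g} {h} G H R = record
    { K = G.K + H.K ; 0≤K = 0≤+ G.0≤K H.0≤K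
    ; bound = λ {z} {u} {v} hz hu hv → ≤-trans (∣p+q∣≤∣p∣+∣q∣ (g z u v) (h z u v))
                (+-mono-≤ (G.bound hz hu hv) (H.bound hz hu hv))
    ; lip = λ {z} {u} {v} {u′} {v′} hz hu hv hu′ hv′ →
        let a = g z u v ; a′ = g z u′ v′ ; b = h z u v ; b′ = h z u′ v′ ; D = dist u v u′ v′ in begin
        ∣ (a + b) - (a′ + b′) ∣           ≡⟨ cong ∣_∣ (solve 4 (λ a b c d → (a :+ b) :- (c :+ d) := (a :- c) :+ (b :- d)) refl a b a′ b′) ⟩
        ∣ (a - a′) + (b - b′) ∣           ≤⟨ ∣p+q∣≤∣p∣+∣q∣ (a - a′) (b - b′) ⟩
        ∣ a - a′ ∣ + ∣ b - b′ ∣           ≤⟨ +-mono-≤ (G.lip hz hu hv hu′ hv′) (H.lip hz hu hv hu′ hv′) ⟩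
        G.K * D + H.K * D                 ≡⟨ *-distribʳ-+ D G.K H.K ⟨
        (G.K + H.K) * D                   ∎ }
    where
    open +-*-Solver
    open ≤-Reasoning
    module G = TameOn (G R)
    module H = TameOn (H R)

  tame-* : ∀ {g h} → Tame g → Tame h → Tame (λ z u v → g z u v * h z u v)
  tame-* {g} {h} G H R = record
    -- One copy suffices for the bound; the Lipschitz estimate has two terms and takes both.
    { K = G.K * H.K + G.K * H.K ; 0≤K = 0≤+ 0≤GH 0≤GH
    ; bound = λ {z} {u} {v} hz hu hv → begin
        ∣ g z u v * h z u v ∣             ≡⟨ ∣p*q∣≡∣p∣*∣q∣ (g z u v) (h z u v) ⟩
        ∣ g z u v ∣ * ∣ h z u v ∣         ≤⟨ *-mono-nonNeg (0≤∣p∣ (g z u v)) (G.bound hz hu hv) (0≤∣p∣ (h z u v)) (H.bound hz hu hv) ⟩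
        G.K * H.K                         ≡⟨ +-identityʳ (G.K * H.K) ⟨
        G.K * H.K + 0ℚ                    ≤⟨ +-monoʳ-≤ (G.K * H.K) 0≤GH ⟩
        G.K * H.K + G.K * H.K             ∎
    ; lip = λ {z} {u} {v} {u′} {v′} hz hu hv hu′ hv′ →
        let a = g z u v ; a′ = g z u′ v′ ; b = h z u v ; b′ = h z u′ v′ ; D = dist u v u′ v′ in begin
        ∣ a * b - a′ * b′ ∣               ≡⟨ cong ∣_∣ (solve 4 (λ a b c d → (a :* b) :- (c :* d) := a :* (b :- d) :+ (a :- c) :* d) refl a b a′ b′) ⟩
        ∣ a * (b - b′) + (a - a′) * b′ ∣  ≤⟨ ∣p+q∣≤∣p∣+∣q∣ (a * (b - b′)) ((a - a′) * b′) ⟩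
        ∣ a * (b - b′) ∣ + ∣ (a - a′) * b′ ∣ ≡⟨ cong₂ _+_ (∣p*q∣≡∣p∣*∣q∣ a (b - b′)) (∣p*q∣≡∣p∣*∣q∣ (a - a′) b′) ⟩
        ∣ a ∣ * ∣ b - b′ ∣ + ∣ a - a′ ∣ * ∣ b′ ∣
          ≤⟨ +-mono-≤ (*-mono-nonNeg (0≤∣p∣ a) (G.bound hz hu hv) (0≤∣p∣ (b - b′)) (H.lip hz hu hv hu′ hv′))
                      (*-mono-nonNeg (0≤∣p∣ (a - a′)) (G.lip hz hu hv hu′ hv′) (0≤∣p∣ b′) (H.bound hz hu′ hv′)) ⟩
        G.K * (H.K * D) + G.K * D * H.K   ≡⟨ solve 3 (λ k l d → k :* (l :* d) :+ k :* d :* l := (k :* l :+ k :* l) :* d) refl G.K H.K D ⟩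
        (G.K * H.K + G.K * H.K) * D       ∎ }
    where
    open +-*-Solver
    open ≤-Reasoning
    module G = TameOn (G R)
    module H = TameOn (H R)
    0≤GH = 0≤* G.0≤K H.0≤K

  -- No limit occurs: the derivative is the diagonal of a divided difference. Tameness of `F` is
  -- carried along because the divided difference of a product contains values of the factors.
  record Derivative (F f : ℚ → ℚ → ℚ) : Set where
    field
      slope   : ℚ → ℚ → ℚ → ℚ
      slope-* : ∀ z u v → F z v - F z u ≡ (v - u) * slope z u v
      diag    : ∀ z t → slope z t t ≡ f z t
      tame    : Tame (λ z u _ → F z u)
      tame-slope : Tame slope

  open ≡-Reasoning

  deriv-ext : ∀ {F F′ f f′} → (∀ z x → F z x ≡ F′ z x) → (∀ z x → f z x ≡ f′ z x) →
    Derivative F f → Derivative F′ f′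
  deriv-ext {F} {F′} {f} {f′} F≗ f≗ D = record
    { slope = slope
    ; slope-* = λ z u v → trans (sym (cong₂ _-_ (F≗ z v) (F≗ z u))) (slope-* z u v)
    ; diag = λ z t → trans (diag z t) (f≗ z t)
    ; tame = tame-ext (λ z u _ → F≗ z u) tame
    ; tame-slope = tame-slope }
    where open Derivative D

  deriv-const : ∀ c → Derivative (λ _ _ → c) (λ _ _ → 0ℚ)
  deriv-const c = record
    { slope = λ _ _ _ → 0ℚ
    ; slope-* = λ _ u v → trans (+-inverseʳ c) (sym (*-zeroʳ (v - u)))
    ; diag = λ _ _ → refl ; tame = tame-const c ; tame-slope = tame-const 0ℚ }

  deriv-param : Derivative (λ z _ → z) (λ _ _ → 0ℚ)
  deriv-param = record
    { slope = λ _ _ _ → 0ℚ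
    ; slope-* = λ z u v → trans (+-inverseʳ z) (sym (*-zeroʳ (v - u)))
    ; diag = λ _ _ → refl ; tame = tame-z ; tame-slope = tame-const 0ℚ }

  deriv-id : Derivative (λ _ x → x) (λ _ _ → 1ℚ)
  deriv-id = record
    { slope = λ _ _ _ → 1ℚ ; slope-* = λ _ u v → sym (*-identityʳ (v - u))
    ; diag = λ _ _ → refl ; tame = tame-u ; tame-slope = tame-const 1ℚ }

  deriv-+ : ∀ {F f G g} → Derivative F f → Derivative G g →
    Derivative (λ z x → F z x + G z x) (λ z x → f z x + g z x)
  deriv-+ {F} {f} {G} {g} DF DG = record
    { slope = λ z u v → DF.slope z u v + DG.slope z u v
    ; slope-* = λ z u v → begin
        (F z v + G z v) - (F z u + G z u)       ≡⟨ solve 4 (λ a b c d → (a :+ b) :- (c :+ d) := (a :- c) :+ (b :- d)) refl (F z v) (G z v) (F z u) (G z u) ⟩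
        (F z v - F z u) + (G z v - G z u)       ≡⟨ cong₂ _+_ (DF.slope-* z u v) (DG.slope-* z u v) ⟩
        (v - u) * DF.slope z u v + (v - u) * DG.slope z u v ≡⟨ *-distribˡ-+ (v - u) (DF.slope z u v) (DG.slope z u v) ⟨
        (v - u) * (DF.slope z u v + DG.slope z u v) ∎
    ; diag = λ z t → cong₂ _+_ (DF.diag z t) (DG.diag z t)
    ; tame = tame-+ DF.tame DG.tame ; tame-slope = tame-+ DF.tame-slope DG.tame-slope }
    where
    open +-*-Solver
    module DF = Derivative DF
    module DG = Derivative DG

  deriv-* : ∀ {F f G g} → Derivative F f → Derivative G g →
    Derivative (λ z x → F z x * G z x) (λ z x → F z x * g z x + G z x * f z x)
  deriv-* {F} {f} {G} {g} DF DG = record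
    -- Taking `F` at `v` but `G` at `u` makes the product rule an exact identity.
    { slope = λ z u v → F z v * DG.slope z u v + G z u * DF.slope z u v
    ; slope-* = λ z u v → begin
        F z v * G z v - F z u * G z u           ≡⟨ solve 4 (λ a b c d → (a :* b) :- (c :* d) := a :* (b :- d) :+ d :* (a :- c)) refl (F z v) (G z v) (F z u) (G z u) ⟩
        F z v * (G z v - G z u) + G z u * (F z v - F z u) ≡⟨ cong₂ (λ s t → F z v * s + G z u * t) (DG.slope-* z u v) (DF.slope-* z u v) ⟩
        F z v * ((v - u) * DG.slope z u v) + G z u * ((v - u) * DF.slope z u v)
          ≡⟨ solve 5 (λ a b d s t → a :* (d :* s) :+ b :* (d :* t) := d :* (a :* s :+ b :* t)) refl (F z v) (G z u) (v - u) (DG.slope z u v) (DF.slope z u v) ⟩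
        (v - u) * (F z v * DG.slope z u v + G z u * DF.slope z u v) ∎
    ; diag = λ z t → cong₂ (λ s r → F z t * s + G z t * r) (DG.diag z t) (DF.diag z t)
    ; tame = tame-* DF.tame DG.tame
    ; tame-slope = tame-+ (tame-* (tame-swap DF.tame) DG.tame-slope) (tame-* DG.tame DF.tame-slope) }
    where
    open +-*-Solver
    module DF = Derivative DF
    module DG = Derivative DG

  deriv-scale : ∀ c {F f} → Derivative F f → Derivative (λ z x → c * F z x) (λ z x → c * f z x)
  deriv-scale c {F} {f} DF = deriv-ext (λ _ _ → refl)
    (λ z x → solve 3 (λ c F f → c :* f :+ F :* con 0ℚ := c :* f) refl c (F z x) (f z x))
    (deriv-* (deriv-const c) DF)
    where open +-*-Solver

  deriv-sum : ∀ N {F f : ℕ → ℚ → ℚ → ℚ} → (∀ k → Derivative (F k) (f k)) →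
    Derivative (λ z x → sum {N} λ i → F (toℕ i) z x) (λ z x → sum {N} λ i → f (toℕ i) z x)
  deriv-sum zero    D = deriv-const 0ℚ
  deriv-sum (suc N) D = deriv-+ (D 0) (deriv-sum N (D ∘ suc))

  -- At `j = 0` the exponent `ℕ.pred j` is a dummy, since it is multiplied by `ι 0`.
  deriv-^ : ∀ {F f} → Derivative F f → ∀ j →
    Derivative (λ z x → F z x ^ j) (λ z x → ι j * F z x ^ ℕ.pred j * f z x)
  deriv-^ {F} {f} D zero = deriv-ext (λ _ _ → refl)
    (λ z x → sym (trans (cong (_* f z x) (*-zeroˡ 1ℚ)) (*-zeroˡ (f z x)))) (deriv-const 1ℚ)
  deriv-^ {F} {f} D (suc j) = deriv-ext (λ _ _ → refl) (λ z x → step z x j) (deriv-* D (deriv-^ D j))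
    where
    open +-*-Solver
    step : ∀ z x j → F z x * (ι j * F z x ^ ℕ.pred j * f z x) + F z x ^ j * f z x ≡ ι (suc j) * F z x ^ j * f z x
    step z x zero = solve 2 (λ F f → F :* (con 0ℚ :* con 1ℚ :* f) :+ con 1ℚ :* f := con 1ℚ :* con 1ℚ :* f) refl (F z x) (f z x)
    step z x (suc j) = trans
      (solve 4 (λ F f i p → F :* (i :* p :* f) :+ (F :* p) :* f := (con 1ℚ :+ i) :* (F :* p) :* f) refl (F z x) (f z x) (ι (suc j)) (F z x ^ j))
      (cong (λ t → t * F z x ^ suc j * f z x) (sym (ι-+ 1 (suc j))))

  deriv-zx : Derivative (λ z x → z * x) (λ z _ → z)
  deriv-zx = deriv-ext (λ _ _ → refl)
    (λ z x → solve 2 (λ z x → z :* con 1ℚ :+ x :* con 0ℚ := z) refl z x) (deriv-* deriv-param deriv-id)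
    where open +-*-Solver

  deriv-zx-1 : Derivative (λ z x → z * x - 1ℚ) (λ z _ → z)
  deriv-zx-1 = deriv-ext (λ _ _ → refl) (λ z _ → +-identityʳ z) (deriv-+ deriv-zx (deriv-const (- 1ℚ)))

  -- Thanks to the bare `x` no factor `z` appears in the derivative, so nothing has to be divided by
  -- `z` later.
  deriv-x[zx]^ : ∀ k → Derivative (λ z x → x * (z * x) ^ k) (λ z x → ι (suc k) * (z * x) ^ k)
  deriv-x[zx]^ k = deriv-ext (λ _ _ → refl) (λ z x → step z x k) (deriv-* deriv-id (deriv-^ deriv-zx k))
    where
    open +-*-Solver
    step : ∀ z x k → x * (ι k * (z * x) ^ ℕ.pred k * z) + (z * x) ^ k * 1ℚ ≡ ι (suc k) * (z * x) ^ k
    step z x zero = solve 2 (λ z x → x :* (con 0ℚ :* con 1ℚ :* z) :+ con 1ℚ :* con 1ℚ := con 1ℚ :* con 1ℚ) refl z x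
    step z x (suc k) = trans
      (solve 4 (λ z x i p → x :* (i :* p :* z) :+ (z :* x) :* p :* con 1ℚ := (con 1ℚ :+ i) :* ((z :* x) :* p)) refl z x (ι (suc k)) ((z * x) ^ k))
      (cong (_* (z * x) ^ suc k) (sym (ι-+ 1 (suc k))))

  deriv-antideriv : ∀ n .{{_ : ℕ.NonZero n}} → Derivative (antideriv n) (λ z x → centralSum n (z * x))
  deriv-antideriv n = deriv-ext (λ _ _ → refl)
    (λ z x → trans (sum-cong n (λ k _ → cong (ν n k *_) (each z x k))) (antideriv-derivative-sum n (z * x)))
    (deriv-sum n (λ k → deriv-scale (ν n k) (deriv-* (deriv-x[zx]^ k) (deriv-^ deriv-zx-1 (n ∸ k)))))
    where
    open +-*-Solver
    each : ∀ z x k → let y = z * x in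
      x * y ^ k * (ι (n ∸ k) * (y - 1ℚ) ^ ℕ.pred (n ∸ k) * z) + (y - 1ℚ) ^ (n ∸ k) * (ι (suc k) * y ^ k) ≡
      ι (suc k) * (y ^ k * (y - 1ℚ) ^ (n ∸ k)) + ι (n ∸ k) * (y ^ suc k * (y - 1ℚ) ^ (n ∸ suc k))
    each z x k = trans
      (cong (λ t → x * y ^ k * (ι (n ∸ k) * (y - 1ℚ) ^ t * z) + w * (ι (suc k) * y ^ k)) (ℕ.pred[m∸n]≡m∸[1+n] n k))
      (solve 7 (λ z x p i j v w → x :* p :* (i :* v :* z) :+ w :* (j :* p) := j :* (p :* w) :+ i :* ((z :* x) :* p :* v))
        refl z x (y ^ k) (ι (n ∸ k)) (ι (suc k)) ((y - 1ℚ) ^ (n ∸ suc k)) w)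
      where
      y = z * x
      w = (y - 1ℚ) ^ (n ∸ k)

  antideriv-0 : ∀ n .{{_ : ℕ.NonZero n}} z → antideriv n z 0ℚ ≡ 0ℚ
  antideriv-0 n z = sum-zero n (λ k _ → solve 3 (λ v a b → v :* (con 0ℚ :* a :* b) := con 0ℚ) refl
    (ν n k) ((z * 0ℚ) ^ k) ((z * 0ℚ - 1ℚ) ^ (n ∸ k)))
    where open +-*-Solver

-- Riemann sums of a derivative.

module Integration where
  open Identities
  open Derivatives
  open D using (ℝ; seq; Eventually; TaggedPartition; riemannSum; IsRiemannIntegral; IsIntegral; fromℚ; *-positive; bounded)
  open D.TaggedPartition
  open import Data.Rational.Base using (_+_; _*_; _-_; -_; ∣_∣; _≤_; _<_)
  open import Data.Rational.Properties hiding (_≤?_)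
  open ℚ^
  open ℚΣ using (sum; sum-cong-≗; *-distribˡ-sum)

  seq-sum : ∀ {n} (x : Fin n → ℝ) m → seq (D.sum x) m ≡ sum (λ i → seq (x i) m)
  seq-sum {zero}  x m = refl
  seq-sum {suc n} x m = cong (_+_ (seq (x zero) m)) (seq-sum (x ∘ suc) m)

  seq-^ : ∀ x n m → seq (x D.^ n) m ≡ seq x m ^ n
  seq-^ x zero    m = refl
  seq-^ x (suc n) m = cong (seq x m *_) (seq-^ x n m)

  always : ∀ {P : ℕ → Set} → (∀ n → P n) → Eventually P
  always p = 0 , λ n _ → p n

  infixl 4 _⊛_
  _⊛_ : ∀ {P Q : ℕ → Set} → Eventually (λ n → P n → Q n) → Eventually P → Eventually Q
  (M , f) ⊛ (N , p) = M ℕ.⊔ N , λ n h → f n (ℕ.m⊔n≤o⇒m≤o M N h) (p n (ℕ.m⊔n≤o⇒n≤o M N h))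

  infixl 4 _<$>_
  _<$>_ : ∀ {P Q : ℕ → Set} → (∀ {n} → P n → Q n) → Eventually P → Eventually Q
  f <$> (N , p) = N , λ n h → f (p n h)

  infix 4 _≼_
  -- The order of `ℝ` on bare sequences: for the sequences of two reals it unfolds to `≤`, and error
  -- terms can be compared without proving them Cauchy.
  _≼_ : (s t : ℕ → ℚ) → Set
  s ≼ t = ∀ ε → 0ℚ < ε → Eventually (λ n → s n ≤ t n + ε)

  0<½* : ∀ {ε} → 0ℚ < ε → 0ℚ < ½ * ε
  0<½* = *-positive (positive⁻¹ ½)

  ≼-refl : ∀ {s} → s ≼ s
  ≼-refl {s} ε 0<ε = always λ n → subst (_≤ s n + ε) (+-identityʳ (s n)) (+-monoʳ-≤ (s n) (<⇒≤ 0<ε))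

  ≼-+ : ∀ {s t u v} → s ≼ t → u ≼ v → ∀ ε → 0ℚ < ε →
    Eventually (λ n → s n + u n ≤ (t n + v n) + ε)
  ≼-+ {s} {t} {u} {v} s≼t u≼v ε 0<ε =
    (λ {n} a b → linear (+-mono-≤ a b) (solve 5 (λ s t u v e →
        (t :+ v) :+ e :- (s :+ u) := (t :+ con ½ :* e) :+ (v :+ con ½ :* e) :- (s :+ u)) refl (s n) (t n) (u n) (v n) ε))
    <$> s≼t (½ * ε) (0<½* 0<ε) ⊛ u≼v (½ * ε) (0<½* 0<ε)
    where open +-*-Solver

  ≼-trans : ∀ {s t u} → s ≼ t → t ≼ u → s ≼ u
  ≼-trans {s} {t} {u} s≼t t≼u ε 0<ε =
    (λ {n} → λ h → linear h (solve 4 (λ s t u e → u :+ e :- s := (t :+ u :+ e) :- (s :+ t)) refl (s n) (t n) (u n) ε))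
    <$> ≼-+ {s} {t} {t} {u} s≼t t≼u ε 0<ε
    where open +-*-Solver

  ≼-sum : ∀ N {s t : Fin N → ℕ → ℚ} → (∀ i → s i ≼ t i) →
    (λ n → sum (λ i → s i n)) ≼ (λ n → sum (λ i → t i n))
  ≼-sum zero    s≼t = ≼-refl {λ _ → 0ℚ}
  ≼-sum (suc N) {s} {t} s≼t = ≼-+ {s zero} {t zero} {λ n → sum (λ i → s (suc i) n)} {λ n → sum (λ i → t (suc i) n)}
    (s≼t zero) (≼-sum N (s≼t ∘ suc))

  module _ {x y} (x≃y : x D.≃ y) where
    ∣≃∣≼0 : (λ n → ∣ seq x n - seq y n ∣) ≼ (λ _ → 0ℚ)
    ∣≃∣≼0 ε 0<ε = (λ {n} h → <⇒≤ (subst (_ <_) (sym (+-identityˡ ε)) h)) <$> x≃y ε 0<ε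

    ≃⇒≤ : x D.≤ y
    ≃⇒≤ ε 0<ε = (λ {n} h → linear (≤-trans (p≤∣p∣ (seq x n - seq y n)) (<⇒≤ h))
      (solve 3 (λ x y e → y :+ e :- x := e :- (x :- y)) refl (seq x n) (seq y n) ε)) <$> x≃y ε 0<ε
      where open +-*-Solver

    ≃⇒≥ : y D.≤ x
    ≃⇒≥ ε 0<ε = (λ {n} h → linear (≤-trans (-p≤∣p∣ (seq x n - seq y n)) (<⇒≤ h))
      (solve 3 (λ x y e → x :+ e :- y := e :- (:- (x :- y))) refl (seq x n) (seq y n) ε)) <$> x≃y ε 0<ε
      where open +-*-Solver

  ≤-chain-lower : ∀ N (p : Fin (suc N) → ℝ) → (∀ i → p (inject₁ i) D.≤ p (suc i)) → ∀ i → p zero D.≤ p i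
  ≤-chain-lower N       p step zero    = ≼-refl {seq (p zero)}
  ≤-chain-lower (suc N) p step (suc i) = ≼-trans {seq (p zero)} {seq (p (suc zero))} {seq (p (suc i))} (step zero) (≤-chain-lower N (p ∘ suc) (step ∘ suc) i)

  ≤-chain-upper : ∀ N (p : Fin (suc N) → ℝ) → (∀ i → p (inject₁ i) D.≤ p (suc i)) → ∀ i → p i D.≤ p (fromℕ N)
  ≤-chain-upper zero    p step zero    = ≼-refl {seq (p zero)}
  ≤-chain-upper (suc N) p step zero    = ≼-trans {seq (p zero)} {seq (p (suc zero))} {seq (p (fromℕ (suc N)))} (step zero) (≤-chain-upper N (p ∘ suc) (step ∘ suc) zero)
  ≤-chain-upper (suc N) p step (suc i) = ≤-chain-upper N (p ∘ suc) (step ∘ suc) i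

  sum-telescope : ∀ N (g : Fin (suc N) → ℚ) → sum (λ i → g (suc i) - g (inject₁ i)) ≡ g (fromℕ N) - g zero
  sum-telescope zero    g = sym (+-inverseʳ (g zero))
  sum-telescope (suc N) g = trans (cong (_+_ (g (suc zero) - g zero)) (sum-telescope N (g ∘ suc)))
    (solve 3 (λ a b c → (b :- a) :+ (c :- b) := c :- a) refl (g zero) (g (suc zero)) (g (fromℕ (suc N))))
    where open +-*-Solver

  ∣sum∣≤sum∣∣ : ∀ N (g : Fin N → ℚ) → ∣ sum g ∣ ≤ sum (λ i → ∣ g i ∣)
  ∣sum∣≤sum∣∣ zero    g = ≤-refl
  ∣sum∣≤sum∣∣ (suc N) g = ≤-trans (∣p+q∣≤∣p∣+∣q∣ (g zero) (sum (g ∘ suc))) (+-monoʳ-≤ ∣ g zero ∣ (∣sum∣≤sum∣∣ N (g ∘ suc)))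

  sum-minus : ∀ N (g h : Fin N → ℚ) → sum (λ i → g i - h i) ≡ sum g - sum h
  sum-minus zero    g h = refl
  sum-minus (suc N) g h = trans (cong (_+_ (g zero - h zero)) (sum-minus N (g ∘ suc) (h ∘ suc)))
    (solve 4 (λ a b c d → (a :- b) :+ (c :- d) := (a :+ c) :- (b :+ d)) refl (g zero) (h zero) (sum (g ∘ suc)) (sum (h ∘ suc)))
    where open +-*-Solver

  -- The witness is ε/(M + 1); the 1 allows `M` to be zero.
  shrink : ∀ M {ε} → 0ℚ ≤ M → 0ℚ < ε → ∃[ η ] 0ℚ < η × M * η ≤ ε
  shrink M {ε} 0≤M 0<ε = η , 0<η , (begin
    M * η                ≤⟨ *-monoʳ-≤-nonNeg η {{ℚ.nonNegative (<⇒≤ 0<η)}} M≤M+1 ⟩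
    (M + 1ℚ) * η         ≡⟨ *-assoc (M + 1ℚ) r ε ⟨
    (M + 1ℚ) * r * ε     ≡⟨ cong (_* ε) (*-inverseʳ (M + 1ℚ) {{pos⇒nonZero (M + 1ℚ) {{M+1-pos}}}}) ⟩
    1ℚ * ε               ≡⟨ *-identityˡ ε ⟩
    ε                    ∎)
    where
    open ≤-Reasoning
    M+1-pos = ℚ.positive (+-mono-≤-< 0≤M (positive⁻¹ 1ℚ))
    r = ℚ.1/_ (M + 1ℚ) {{pos⇒nonZero (M + 1ℚ) {{M+1-pos}}}}
    η = r * ε
    0<η = *-positive (positive⁻¹ r {{1/pos⇒pos (M + 1ℚ) {{M+1-pos}}}}) 0<ε
    M≤M+1 : M ≤ M + 1ℚ
    M≤M+1 = subst (_≤ M + 1ℚ) (+-identityʳ M) (+-monoʳ-≤ M (nonNegative⁻¹ 1ℚ))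

  0<⊓ : ∀ {p q} → 0ℚ < p → 0ℚ < q → ∃[ η ] 0ℚ < η × η ≤ p × η ≤ q
  0<⊓ {p} {q} 0<p 0<q with ≤-total p q
  ... | inj₁ p≤q = p , 0<p , ≤-refl , p≤q
  ... | inj₂ q≤p = q , 0<q , q≤p , ≤-refl

  ≼-scale : ∀ {M s t} → 0ℚ ≤ M → s ≼ t → (λ n → M * s n) ≼ (λ n → M * t n)
  ≼-scale {M} {s} {t} 0≤M s≼t ε 0<ε =
    let η , 0<η , Mη≤ε = shrink M 0≤M 0<ε in (λ {n} h → begin
      M * s n              ≤⟨ *-monoˡ-≤-nonNeg M {{ℚ.nonNegative 0≤M}} h ⟩
      M * (t n + η)        ≡⟨ *-distribˡ-+ M (t n) η ⟩
      M * t n + M * η      ≤⟨ +-monoʳ-≤ (M * t n) Mη≤ε ⟩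
      M * t n + ε          ∎) <$> s≼t η 0<η
    where open ≤-Reasoning

  -- For real u ≤ t ≤ v the n-th approximations satisfy these inequalities only
  -- up to an arbitrarily small η, hence the last term.
  module _ {F f} (DF : Derivative F f) {R : ℚ} where
    open Derivative DF
    module Slope = TameOn (tame-slope R)
    open Slope using (K; 0≤K)

    increment-error : ∀ {z u v t δ η} → ∣ z ∣ ≤ R → ∣ u ∣ ≤ R → ∣ v ∣ ≤ R → ∣ t ∣ ≤ R →
      u ≤ t + η → t ≤ v + η → v - u ≤ δ → 0ℚ ≤ η → η ≤ δ →
      ∣ (F z v - F z u) - f z t * (v - u) ∣ ≤ (ι 4 * K * δ) * (v - u) + (ι 4 * (ι 4 * K * δ)) * η
    increment-error {z} {u} {v} {t} {δ} {η} hz hu hv ht u≤t t≤v w≤δ 0≤η η≤δ = begin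
      ∣ (F z v - F z u) - f z t * (v - u) ∣
        ≡⟨ cong ∣_∣ (trans (cong₂ (λ a b → a - b * (v - u)) (slope-* z u v) (sym (diag z t)))
             (solve 3 (λ w s r → w :* s :- r :* w := w :* (s :- r)) refl (v - u) (slope z u v) (slope z t t))) ⟩
      ∣ (v - u) * (slope z u v - slope z t t) ∣
        ≡⟨ ∣p*q∣≡∣p∣*∣q∣ (v - u) (slope z u v - slope z t t) ⟩
      ∣ v - u ∣ * ∣ slope z u v - slope z t t ∣
        ≤⟨ *-mono-nonNeg (0≤∣p∣ (v - u)) width-bound (0≤∣p∣ (slope z u v - slope z t t))
             (≤-trans (Slope.lip hz hu hv ht ht)
               (*-monoˡ-≤-nonNeg K {{ℚ.nonNegative 0≤K}} (+-mono-≤ u-near v-near))) ⟩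
      ((v - u) + ι 4 * η) * (K * ((δ + δ) + (δ + δ)))
        ≡⟨ solve 4 (λ w η K δ → (w :+ con (ι 4) :* η) :* (K :* ((δ :+ δ) :+ (δ :+ δ))) :=
             (con (ι 4) :* K :* δ) :* w :+ (con (ι 4) :* (con (ι 4) :* K :* δ)) :* η) refl (v - u) η K δ ⟩
      (ι 4 * K * δ) * (v - u) + (ι 4 * (ι 4 * K * δ)) * η ∎
      where
      open +-*-Solver
      open ≤-Reasoning
      0≤δ = ≤-trans 0≤η η≤δ
      -- From u ≤ t + η ≤ v + 2η the width is at least -2η; reflecting it costs twice that, hence
      -- 4η.
      width-bound : ∣ v - u ∣ ≤ (v - u) + ι 4 * η
      width-bound = ∣∣-least
        (linear (0≤+ (0≤+ 0≤η 0≤η) (0≤+ 0≤η 0≤η)) (solve 2 (λ w η → w :+ con (ι 4) :* η :- w := (η :+ η) :+ (η :+ η) :- con 0ℚ) refl (v - u) η))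
        (linear (+-mono-≤ (+-mono-≤ u≤t t≤v) (+-mono-≤ u≤t t≤v))
          (solve 4 (λ u v t η → (v :- u) :+ con (ι 4) :* η :- (:- (v :- u)) :=
            ((t :+ η) :+ (v :+ η)) :+ ((t :+ η) :+ (v :+ η)) :- ((u :+ t) :+ (u :+ t))) refl u v t η))
      -- Each endpoint is within δ + η ≤ 2δ of the tag, so (u, v) has `dist` at most 4δ from (t, t);
      -- this is the 4 in `ι 4 * K * δ`.
      u-near : ∣ u - t ∣ ≤ δ + δ
      u-near = ∣∣-least
        (linear (+-mono-≤ u≤t (+-mono-≤ η≤δ 0≤δ)) (solve 4 (λ u t η δ → δ :+ δ :- (u :- t) := (t :+ η) :+ (δ :+ δ) :- (u :+ (η :+ con 0ℚ))) refl u t η δ))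
        (linear (+-mono-≤ t≤v (+-mono-≤ w≤δ η≤δ)) (solve 5 (λ u v t η δ → δ :+ δ :- (:- (u :- t)) := (v :+ η) :+ (δ :+ δ) :- (t :+ ((v :- u) :+ η))) refl u v t η δ))
      v-near : ∣ v - t ∣ ≤ δ + δ
      v-near = ∣∣-least
        (linear (+-mono-≤ u≤t (+-mono-≤ w≤δ η≤δ)) (solve 5 (λ u v t η δ → δ :+ δ :- (v :- t) := (t :+ η) :+ (δ :+ δ) :- (u :+ ((v :- u) :+ η))) refl u v t η δ))
        (linear (+-mono-≤ t≤v (+-mono-≤ η≤δ 0≤δ)) (solve 4 (λ v t η δ → δ :+ δ :- (:- (v :- t)) := (v :+ η) :+ (δ :+ δ) :- (t :+ (η :+ con 0ℚ))) refl v t η δ))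

    -- Bounding the divided difference gives a Lipschitz constant for `F`. It is applied at the ends
    -- of a partition, which meet a and b only up to `≃`.
    derivative-lipschitz : ∀ {z u v} → ∣ z ∣ ≤ R → ∣ u ∣ ≤ R → ∣ v ∣ ≤ R →
      ∣ F z u - F z v ∣ ≤ K * ∣ u - v ∣
    derivative-lipschitz {z} {u} {v} hz hu hv = begin
      ∣ F z u - F z v ∣           ≡⟨ trans (cong ∣_∣ (slope-* z v u)) (∣p*q∣≡∣p∣*∣q∣ (u - v) (slope z v u)) ⟩
      ∣ u - v ∣ * ∣ slope z v u ∣ ≤⟨ *-monoˡ-≤-nonNeg ∣ u - v ∣ {{∣-∣-nonNeg (u - v)}} (Slope.bound hz hv hu) ⟩
      ∣ u - v ∣ * K               ≡⟨ *-comm ∣ u - v ∣ K ⟩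
      K * ∣ u - v ∣               ∎
      where open ≤-Reasoning

  private module _ where
    open +-*-Solver

    ∣x∣≤½e₀⇒-e+½e₀≤x : ∀ {x e e₀} → ∣ x ∣ ≤ ½ * e₀ → 0ℚ + e₀ ≤ e → - e + ½ * e₀ ≤ x
    ∣x∣≤½e₀⇒-e+½e₀≤x {x} {e} {e₀} h k = linear (+-mono-≤ (≤-trans (-p≤∣p∣ x) h) k)
      (solve 3 (λ x e e₀ → x :- (:- e :+ con ½ :* e₀) := (con ½ :* e₀ :+ e) :- (:- x :+ (con 0ℚ :+ e₀))) refl x e e₀)

    ∣x∣≤½e₀⇒x+½e₀≤e : ∀ {x e e₀} → ∣ x ∣ ≤ ½ * e₀ → 0ℚ + e₀ ≤ e → x + ½ * e₀ ≤ e
    ∣x∣≤½e₀⇒x+½e₀≤e {x} {e} {e₀} h k = linear (+-mono-≤ (≤-trans (p≤∣p∣ x) h) k)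
      (solve 3 (λ x e e₀ → e :- (x :+ con ½ :* e₀) := (con ½ :* e₀ :+ e) :- (x :+ (con 0ℚ :+ e₀))) refl x e e₀)

    -- Lying between a and b is known up to any positive error; the final 1 is the error chosen, and
    -- `Z` makes room for the parameter so that one radius fits everything.
    between-bound : ∀ {A B Z a b x} → 0ℚ ≤ A → 0ℚ ≤ B → 0ℚ ≤ Z → ∣ a ∣ ≤ A → ∣ b ∣ ≤ B →
      a ≤ x + 1ℚ → x ≤ b + 1ℚ → ∣ x ∣ ≤ A + B + Z + 1ℚ
    between-bound {A} {B} {Z} {a} {b} {x} 0≤A 0≤B 0≤Z ha hb a≤ ≤b = ∣∣-least
      (linear (+-mono-≤ ≤b (+-mono-≤ (≤-trans (p≤∣p∣ b) hb) (0≤+ 0≤A 0≤Z)))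
        (solve 5 (λ A B Z x b → A :+ B :+ Z :+ con 1ℚ :- x := (b :+ con 1ℚ) :+ (B :+ (A :+ Z)) :- (x :+ (b :+ con 0ℚ)))
          refl A B Z x b))
      (linear (+-mono-≤ a≤ (+-mono-≤ (≤-trans (-p≤∣p∣ a) ha) (0≤+ 0≤B 0≤Z)))
        (solve 5 (λ A B Z x a → A :+ B :+ Z :+ con 1ℚ :- (:- x) := (x :+ con 1ℚ) :+ (A :+ (B :+ Z)) :- (a :+ (:- a :+ con 0ℚ)))
          refl A B Z x a))

    third-bound : ∀ {A B Z z} → 0ℚ ≤ A → 0ℚ ≤ B → ∣ z ∣ ≤ Z → ∣ z ∣ ≤ A + B + Z + 1ℚ
    third-bound {A} {B} {Z} {z} 0≤A 0≤B h = linear (+-mono-≤ h (0≤+ (0≤+ 0≤A 0≤B) (nonNegative⁻¹ 1ℚ)))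
      (solve 4 (λ A B Z z → A :+ B :+ Z :+ con 1ℚ :- z := Z :+ (A :+ B :+ con 1ℚ) :- (z :+ con 0ℚ)) refl A B Z ∣ z ∣)

    w+e≤δ⇒w≤δ : ∀ {w e δ} → 0ℚ < e → w + e ≤ δ → w ≤ δ
    w+e≤δ⇒w≤δ {w} {e} {δ} 0<e w+e≤δ = linear (+-mono-≤ w+e≤δ (<⇒≤ 0<e))
      (solve 3 (λ w e d → d :- w := d :+ e :- (w :+ e :+ con 0ℚ)) refl w e δ)

    -- Separates the mismatch at the two ends from the accumulated increment errors; the last four
    -- variables stand for values of F.
    gap-split : ∀ S a b p₀ p₁ → S - (b - a) ≡ ((p₁ - b) - (p₀ - a)) - ((p₁ - p₀) - S)
    gap-split = solve 5 (λ S a b p₀ p₁ → S :- (b :- a) := ((p₁ :- b) :- (p₀ :- a)) :- ((p₁ :- p₀) :- S)) refl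

    gap-bound : ∀ K κ → (K * 0ℚ + K * 0ℚ) + κ + ((κ + κ) + κ) ≡ (κ + κ) + (κ + κ)
    gap-bound = solve 2 (λ K e → (K :* con 0ℚ :+ K :* con 0ℚ) :+ e :+ ((e :+ e) :+ e) := (e :+ e) :+ (e :+ e)) refl

    four-eighths : ∀ e → let κ = ½ * (½ * (½ * e)) in (κ + κ) + (κ + κ) ≡ ½ * e
    four-eighths = solve 1 (λ e → let κ = con ½ :* (con ½ :* (con ½ :* e)) in (κ :+ κ) :+ (κ :+ κ) := con ½ :* e) refl

    neg-minus : ∀ a b → - (b - a) ≡ a - b
    neg-minus = solve 2 (λ a b → :- (b :- a) := a :- b) refl

    total-width : ∀ K d R → ι 4 * K * d * (R + R) ≡ (R + R) * (ι 4 * K) * d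
    total-width = solve 3 (λ K d R → con (ι 4) :* K :* d :* (R :+ R) := (R :+ R) :* (con (ι 4) :* K) :* d) refl

  module _ {F f} (DF : Derivative F f) (z : ℝ) {g : ℝ → ℝ}
           (g-seq : ∀ x n → seq (g x) n ≡ f (seq z n) (seq x n))
           {a b : ℝ} (I : ℝ) (I-seq : ∀ n → seq I n ≡ F (seq z n) (seq b n) - F (seq z n) (seq a n)) where

    module _ {R : ℚ} (z-ball : Eventually (λ n → ∣ seq z n ∣ ≤ R))
             (ball : ∀ x → a D.≤ x → x D.≤ b → Eventually (λ n → ∣ seq x n ∣ ≤ R))
             {δ κ : ℚ} (0<δ : 0ℚ < δ) (0<κ : 0ℚ < κ)
             (δ-small : (R + R) * (ι 4 * TameOn.K (Derivative.tame-slope DF R)) * δ ≤ κ + κ)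
             (π : TaggedPartition a b) (narrow : ∀ i → width π i D.< fromℚ δ) where

      private
        open TameOn (Derivative.tame-slope DF R) using (K; 0≤K)

        Λ    = ι 4 * K * δ
        0≤Λ : 0ℚ ≤ Λ
        0≤Λ  = 0≤* (0≤* (nonNegative⁻¹ (ι 4)) 0≤K) (<⇒≤ 0<δ)
        0≤4Λ : 0ℚ ≤ ι 4 * Λ
        0≤4Λ = 0≤* (nonNegative⁻¹ (ι 4)) 0≤Λ

        N = size π
        p : Fin (suc N) → ℕ → ℚ
        p i = seq (point π i)
        P₀ P₁ : ℕ → ℚ
        P₀ = p zero
        P₁ = p (fromℕ N)
        w err : Fin N → ℕ → ℚ
        w i n = p (suc i) n - p (inject₁ i) n
        err i n = (F (seq z n) (p (suc i) n) - F (seq z n) (p (inject₁ i) n))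
                  - f (seq z n) (seq (tag π i) n) * w i n

        p-step : ∀ i → point π (inject₁ i) D.≤ point π (suc i)
        p-step i = ≼-trans {p (inject₁ i)} {seq (tag π i)} {p (suc i)} (point≤tag π i) (tag≤point π i)
        a≤p : ∀ i → a D.≤ point π i
        a≤p i = ≼-trans {seq a} {P₀} {p i} (≃⇒≥ {point π zero} {a} (start π)) (≤-chain-lower N (point π) p-step i)
        p≤b : ∀ i → point π i D.≤ b
        p≤b i = ≼-trans {p i} {P₁} {seq b} (≤-chain-upper N (point π) p-step i) (≃⇒≤ {point π (fromℕ N)} {b} (end π))
        -- The ascending points order the endpoints, which places `a` and `b` themselves in the
        -- ball.
        a≤b : a D.≤ b
        a≤b = ≼-trans {seq a} {P₀} {seq b} (a≤p zero) (p≤b zero)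

        p-ball : ∀ i → Eventually (λ n → ∣ p i n ∣ ≤ R)
        p-ball i = ball (point π i) (a≤p i) (p≤b i)
        tag-ball : ∀ i → Eventually (λ n → ∣ seq (tag π i) n ∣ ≤ R)
        tag-ball i = ball (tag π i)
          (≼-trans {seq a} {p (inject₁ i)} {seq (tag π i)} (a≤p (inject₁ i)) (point≤tag π i))
          (≼-trans {seq (tag π i)} {p (suc i)} {seq b} (tag≤point π i) (p≤b (suc i)))

        err≼ : ∀ i → (λ n → ∣ err i n ∣) ≼ (λ n → Λ * w i n)
        err≼ i η₀ 0<η₀ =
          -- Unlike δ, `η` is chosen after the partition and as small as the requested accuracy `η₀`
          -- demands, so the last term of `increment-error` is absorbed.
          let η₁ , 0<η₁ , 4Λη₁≤η₀ = shrink (ι 4 * Λ) 0≤4Λ 0<η₀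
              η , 0<η , η≤η₁ , η≤δ = 0<⊓ 0<η₁ 0<δ
              e , 0<e , M , w+e≤δ = narrow i
          in (λ {n} hz hu hv ht u≤t t≤v w≤δ → ≤-trans
                (increment-error DF hz hu hv ht u≤t t≤v (w+e≤δ⇒w≤δ 0<e w≤δ) (<⇒≤ 0<η) η≤δ)
                (+-monoʳ-≤ (Λ * w i n) (≤-trans (*-monoˡ-≤-nonNeg (ι 4 * Λ) {{ℚ.nonNegative 0≤4Λ}} η≤η₁) 4Λη₁≤η₀)))
             <$> z-ball ⊛ p-ball (inject₁ i) ⊛ p-ball (suc i) ⊛ tag-ball i
             ⊛ point≤tag π i η 0<η ⊛ tag≤point π i η 0<η ⊛ (M , w+e≤δ)

        sum-err≼ : (λ n → sum (λ i → ∣ err i n ∣)) ≼ (λ n → sum (λ i → Λ * w i n))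
        sum-err≼ = ≼-sum N {λ i n → ∣ err i n ∣} {λ i n → Λ * w i n} err≼

        ends≼ : ∀ ε → 0ℚ < ε → Eventually (λ n →
          K * ∣ P₁ n - seq b n ∣ + K * ∣ P₀ n - seq a n ∣ ≤ (K * 0ℚ + K * 0ℚ) + ε)
        ends≼ = ≼-+ {λ n → K * ∣ P₁ n - seq b n ∣} {λ _ → K * 0ℚ} {λ n → K * ∣ P₀ n - seq a n ∣} {λ _ → K * 0ℚ}
          (≼-scale {s = λ n → ∣ P₁ n - seq b n ∣} {λ _ → 0ℚ} 0≤K (∣≃∣≼0 {point π (fromℕ N)} {b} (end π)))
          (≼-scale {s = λ n → ∣ P₀ n - seq a n ∣} {λ _ → 0ℚ} 0≤K (∣≃∣≼0 {point π zero} {a} (start π)))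

        S : ℕ → ℚ
        S n = sum (λ i → f (seq z n) (seq (tag π i) n) * w i n)

        S≡ : ∀ n → seq (riemannSum g π) n ≡ S n
        S≡ n = trans (seq-sum (λ i → g (tag π i) D.* width π i) n)
                     (sum-cong-≗ (λ i → cong (_* w i n) (g-seq (tag π i) n)))

        sum-err : ∀ n → sum (λ i → err i n) ≡ (F (seq z n) (P₁ n) - F (seq z n) (P₀ n)) - S n
        sum-err n = trans
          (sum-minus N (λ i → F (seq z n) (p (suc i) n) - F (seq z n) (p (inject₁ i) n)) (λ i → f (seq z n) (seq (tag π i) n) * w i n))
          (cong (_- S n) (sum-telescope N (λ i → F (seq z n) (p i n))))

        estimate : ∀ n → ∣ seq z n ∣ ≤ R → ∣ P₀ n ∣ ≤ R → ∣ P₁ n ∣ ≤ R → ∣ seq a n ∣ ≤ R → ∣ seq b n ∣ ≤ R →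
          sum (λ i → ∣ err i n ∣) ≤ sum (λ i → Λ * w i n) + κ →
          K * ∣ P₁ n - seq b n ∣ + K * ∣ P₀ n - seq a n ∣ ≤ (K * 0ℚ + K * 0ℚ) + κ →
          ∣ seq (riemannSum g π D.- I) n ∣ ≤ (κ + κ) + (κ + κ)
        estimate n hz hp₀ hp₁ ha hb total ends = begin
          ∣ seq (riemannSum g π) n - seq I n ∣
            ≡⟨ cong₂ (λ s t → ∣ s - t ∣) (S≡ n) (I-seq n) ⟩
          ∣ S n - (F ζ (seq b n) - F ζ (seq a n)) ∣
            ≡⟨ cong ∣_∣ (trans (gap-split (S n) (F ζ (seq a n)) (F ζ (seq b n)) (F ζ (P₀ n)) (F ζ (P₁ n)))
                 (cong (λ t → (ΔF₁ - ΔF₀) - t) (sym (sum-err n)))) ⟩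
          ∣ (ΔF₁ - ΔF₀) - sum (λ i → err i n) ∣
            ≤⟨ ∣p-q∣≤∣p∣+∣q∣ (ΔF₁ - ΔF₀) (sum (λ i → err i n)) ⟩
          ∣ ΔF₁ - ΔF₀ ∣ + ∣ sum (λ i → err i n) ∣
            ≤⟨ +-mono-≤ (≤-trans (∣p-q∣≤∣p∣+∣q∣ ΔF₁ ΔF₀)
                          (≤-trans (+-mono-≤ (derivative-lipschitz DF hz hp₁ hb) (derivative-lipschitz DF hz hp₀ ha)) ends))
                        (≤-trans (∣sum∣≤sum∣∣ N (λ i → err i n)) (≤-trans total (+-monoˡ-≤ κ main))) ⟩
          -- The error budget: one κ for the ends, two for the widths, one for the slack of the
          -- approximations.
          (K * 0ℚ + K * 0ℚ) + κ + ((κ + κ) + κ)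
            ≡⟨ gap-bound K κ ⟩
          (κ + κ) + (κ + κ) ∎
          where
          open ≤-Reasoning
          ζ = seq z n
          ΔF₁ = F ζ (P₁ n) - F ζ (seq b n)
          ΔF₀ = F ζ (P₀ n) - F ζ (seq a n)

          -- The widths telescope to at most 2R, and 2R · 4K · δ is what `δ-small` controls.
          main : sum (λ i → Λ * w i n) ≤ κ + κ
          main = begin
            sum (λ i → Λ * w i n)     ≡⟨ *-distribˡ-sum {N} Λ (λ i → w i n) ⟨
            Λ * sum (λ i → w i n)     ≡⟨ cong (Λ *_) (sum-telescope N (λ i → p i n)) ⟩
            Λ * (P₁ n - P₀ n)         ≤⟨ *-monoˡ-≤-nonNeg Λ {{ℚ.nonNegative 0≤Λ}}
                                          (+-mono-≤ (≤-trans (p≤∣p∣ (P₁ n)) hp₁) (≤-trans (-p≤∣p∣ (P₀ n)) hp₀)) ⟩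
            Λ * (R + R)               ≡⟨ total-width K δ R ⟩
            (R + R) * (ι 4 * K) * δ   ≤⟨ δ-small ⟩
            κ + κ                     ∎

      riemannSum-near : Eventually (λ n → ∣ seq (riemannSum g π D.- I) n ∣ ≤ (κ + κ) + (κ + κ))
      riemannSum-near = (λ {n} → estimate n)
        <$> z-ball ⊛ p-ball zero ⊛ p-ball (fromℕ N) ⊛ ball a (≼-refl {seq a}) a≤b ⊛ ball b a≤b (≼-refl {seq b})
        ⊛ sum-err≼ κ 0<κ ⊛ ends≼ κ 0<κ

    -- With κ an eighth of ε₀ the total error 4κ is half of ε₀; the other half is the positive
    -- rational gap that `<` on `ℝ` asks for.
    riemannSum-within : ∀ {R} (z-ball : Eventually (λ n → ∣ seq z n ∣ ≤ R))
      (ball : ∀ x → a D.≤ x → x D.≤ b → Eventually (λ n → ∣ seq x n ∣ ≤ R))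
      (ε : ℝ) {ε₀ δ} → 0ℚ < ε₀ → Eventually (λ n → 0ℚ + ε₀ ≤ seq ε n) → 0ℚ < δ →
      let K = TameOn.K (Derivative.tame-slope DF R) ; κ = ½ * (½ * (½ * ε₀)) in
      (R + R) * (ι 4 * K) * δ ≤ κ + κ →
      (π : TaggedPartition a b) → (∀ i → width π i D.< fromℚ δ) →
      (D.- ε D.< riemannSum g π D.- I) × (riemannSum g π D.- I D.< ε)
    riemannSum-within {R} z-ball ball ε {ε₀} {δ} 0<ε₀ ε₀≤ε 0<δ δ-small π narrow =
        (½ * ε₀ , 0<½* 0<ε₀ , ((λ {n} → ∣x∣≤½e₀⇒-e+½e₀≤x {gap n} {seq ε n} {ε₀}) <$> close ⊛ ε₀≤ε))
      , (½ * ε₀ , 0<½* 0<ε₀ , ((λ {n} → ∣x∣≤½e₀⇒x+½e₀≤e {gap n} {seq ε n} {ε₀}) <$> close ⊛ ε₀≤ε))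
      where
      gap : ℕ → ℚ
      gap n = seq (riemannSum g π D.- I) n
      close : Eventually (λ n → ∣ gap n ∣ ≤ ½ * ε₀)
      close = (λ {n} → subst (∣ gap n ∣ ≤_) (four-eighths ε₀))
        <$> riemannSum-near {R} z-ball ball {δ} {½ * (½ * (½ * ε₀))} 0<δ (0<½* (0<½* (0<½* 0<ε₀))) δ-small π narrow

    derivative-riemann : IsRiemannIntegral g a b I
    derivative-riemann = from-bounds (bounded a) (bounded b) (bounded z)
      where
      Bounded : ℝ → Set
      Bounded x = ∃[ B ] (0ℚ < B × Eventually (λ n → ∣ seq x n ∣ ≤ B))

      from-bounds : Bounded a → Bounded b → Bounded z → IsRiemannIntegral g a b I
      from-bounds (A , 0<A , ∣a∣≤A) (B , 0<B , ∣b∣≤B) (Z , 0<Z , ∣z∣≤Z) ε (ε₀ , 0<ε₀ , ε₀≤ε) =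
        let 0≤A = <⇒≤ 0<A ; 0≤B = <⇒≤ 0<B ; 0≤Z = <⇒≤ 0<Z
            R = A + B + Z + 1ℚ
            0≤R = 0≤+ (0≤+ (0≤+ 0≤A 0≤B) 0≤Z) (nonNegative⁻¹ 1ℚ)
            open TameOn (Derivative.tame-slope DF R) using (K; 0≤K)
            0<κ = 0<½* (0<½* (0<½* 0<ε₀))
            -- This depends on the bounds and on ε₀ but on no partition, as the order of quantifiers
            -- in the integral requires.
            δ , 0<δ , δ-small = shrink ((R + R) * (ι 4 * K))
              (0≤* (0≤+ 0≤R 0≤R) (0≤* (nonNegative⁻¹ (ι 4)) 0≤K)) (+-mono-< 0<κ 0<κ)
        in fromℚ δ , (δ , 0<δ , always λ _ → ≤-reflexive (+-identityˡ δ)) ,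
           riemannSum-within {R} (third-bound 0≤A 0≤B <$> ∣z∣≤Z)
              (λ x a≤x x≤b → between-bound 0≤A 0≤B 0≤Z <$> ∣a∣≤A ⊛ ∣b∣≤B
                 ⊛ a≤x 1ℚ (positive⁻¹ 1ℚ) ⊛ x≤b 1ℚ (positive⁻¹ 1ℚ))
              ε {ε₀} {δ} 0<ε₀ ε₀≤ε 0<δ δ-small

  module _ {F f} (DF : Derivative F f) (z : ℝ) {g : ℝ → ℝ}
           (g-seq : ∀ x n → seq (g x) n ≡ f (seq z n) (seq x n)) where

    -- Swapping the endpoints negates F(b) - F(a), so one estimate serves both orientations.
    derivative-integral : ∀ {a b} I → (∀ n → seq I n ≡ F (seq z n) (seq b n) - F (seq z n) (seq a n)) →
      IsIntegral g a b I
    derivative-integral {a} {b} I I-seq =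
      (λ _ → derivative-riemann {F} {f} DF z {g} g-seq {a} {b} I I-seq) ,
      (λ _ → derivative-riemann {F} {f} DF z {g} g-seq {b} {a} (D.- I) λ n →
        trans (cong -_ (I-seq n)) (neg-minus (F (seq z n) (seq a n)) (F (seq z n) (seq b n))))

-- Transfer to the real numbers.

open import Defs
open Identities
open Derivatives using (deriv-antideriv; antideriv-0)
open Integration using (seq-sum; seq-^; derivative-integral)

seq-* : ∀ x y {s t} m → seq x m ≡ s → seq y m ≡ t → seq (x * y) m ≡ s ℚ.* t
seq-* x y m = cong₂ ℚ._*_

seq-P : ∀ n x m → seq (P n x) m ≡ legendre n (seq x m)
seq-P n x m = cong₂ ℚ._*_ (seq-^ (fromℚ ½) n m)
  (trans (seq-sum {suc ⌊ n /2⌋} (term ∘ toℕ) m) (ℚΣ.sum-cong-≗ {suc ⌊ n /2⌋} λ i → let k = toℕ i in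
    cong₂ (λ s t → s ℚ.* ι (((n ∸ k) C k) ℕ.* ((2 ℕ.* n ∸ 2 ℕ.* k) C (n ∸ k))) ℚ.* t)
      (seq-^ (- 1ℝ) k m) (seq-^ x (n ∸ 2 ℕ.* k) m)))
  where
  term : ℕ → ℝ
  term k = (- 1ℝ) ^ k * ℕ→ℝ (((n ∸ k) C k) ℕ.* ((2 ℕ.* n ∸ 2 ℕ.* k) C (n ∸ k))) * x ^ (n ∸ 2 ℕ.* k)

-- Equality of reals ignores finitely many indices. This admits identities that rely on an inverse
-- of q - 1, whose early approximations may be 0, where `recip` returns 0.
eventually-≡⇒≃ : ∀ x y {Q : ℕ → Set} → Eventually Q → (∀ m → Q m → seq x m ≡ seq y m) → x ≃ y
eventually-≡⇒≃ x y (N , q) eq ε 0<ε = N , λ m N≤m →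
  subst (λ t → ℚ.∣ t ∣ ℚ.< ε) (sym (trans (cong (ℚ._- seq y m) (eq m (q m N≤m))) (ℚ.+-inverseʳ (seq y m)))) 0<ε

recip-eventually : ∀ x → x # 0ℝ → Eventually (λ m → recip (seq x m) ℚ.* seq x m ≡ 1ℚ)
recip-eventually x x#0 =
  let η , 0<η , N , away = awayFromZero x x#0
  in N , λ m N≤m → recip-inverse (seq x m) λ x≡0 →
    ℚ.<-irrefl refl (ℚ.<-≤-trans 0<η (subst (λ t → η ℚ.≤ ℚ.∣ t ∣) x≡0 (away m N≤m)))

module _ (n : ℕ) .{{n≢0 : NonZero n}} where

  seq-𝔑 : ∀ q m → seq (𝔑 n {{n≢0}} q) m ≡ narayana n (seq q m)
  seq-𝔑 q m = trans (seq-sum {n} _ m)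
    (ℚΣ.sum-cong-≗ {n} λ i → cong (ν n (toℕ i) ℚ.*_) (seq-^ q (suc (toℕ i)) m))

  antiderivℝ : ℝ → ℝ → ℝ
  antiderivℝ z x = sum {n} λ i → let k = toℕ i in
    fromℚ (ν n k) * (x * (z * x) ^ k * (z * x - 1ℝ) ^ (n ∸ k))

  seq-antiderivℝ : ∀ z x m → seq (antiderivℝ z x) m ≡ antideriv n (seq z m) (seq x m)
  seq-antiderivℝ z x m = trans (seq-sum {n} _ m)
    (ℚΣ.sum-cong-≗ {n} λ i → let k = toℕ i in
      cong₂ (λ s t → ν n k ℚ.* (seq x m ℚ.* s ℚ.* t)) (seq-^ (z * x) k m) (seq-^ (z * x - 1ℝ) (n ∸ k) m))

  seq-antiderivℝ′ : ∀ z x {s t} m → seq z m ≡ s → seq x m ≡ t →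
    seq (antiderivℝ z x) m ≡ antideriv n s t
  seq-antiderivℝ′ z x m refl refl = seq-antiderivℝ z x m

  -- Keeping `c` apart from 2z covers both `2ℝ` with z = 1 and 2q/(q - 1) with z = y, each in the
  -- form in which the theorem writes it.
  seq-P[cx-1] : ∀ {z c} → (∀ m → seq c m ≡ ι 2 ℚ.* seq z m) → ∀ x m →
    seq (P n (c * x - 1ℝ)) m ≡ centralSum n (seq z m ℚ.* seq x m)
  seq-P[cx-1] {z} {c} c≡2z x m = begin
    seq (P n (c * x - 1ℝ)) m                                ≡⟨ seq-P n (c * x - 1ℝ) m ⟩
    legendre n (seq c m ℚ.* seq x m ℚ.- 1ℚ)                 ≡⟨ cong (λ t → legendre n (t ℚ.* seq x m ℚ.- 1ℚ)) (c≡2z m) ⟩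
    legendre n (ι 2 ℚ.* seq z m ℚ.* seq x m ℚ.- 1ℚ)         ≡⟨ cong (λ t → legendre n (t ℚ.- 1ℚ)) (ℚ.*-assoc (ι 2) (seq z m) (seq x m)) ⟩
    legendre n (ι 2 ℚ.* (seq z m ℚ.* seq x m) ℚ.- 1ℚ)       ≡⟨ legendre-centralSum n (seq z m ℚ.* seq x m) ⟩
    centralSum n (seq z m ℚ.* seq x m)                      ∎
    where open ≡-Reasoning

  legendre-integral : ∀ z b c → (∀ m → seq c m ≡ ι 2 ℚ.* seq z m) →
    IsIntegral (λ x → P n (c * x - 1ℝ)) 0ℝ b (antiderivℝ z b)
  legendre-integral z b c c≡2z = derivative-integral
    {antideriv n} {λ z x → centralSum n (z ℚ.* x)} (deriv-antideriv n) z
    {λ x → P n (c * x - 1ℝ)} (seq-P[cx-1] {z} {c} c≡2z) {0ℝ} {b} (antiderivℝ z b) difference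
    where
    difference : ∀ m → seq (antiderivℝ z b) m ≡ antideriv n (seq z m) (seq b m) ℚ.- antideriv n (seq z m) 0ℚ
    difference m = begin
      seq (antiderivℝ z b) m                                           ≡⟨ seq-antiderivℝ z b m ⟩
      antideriv n (seq z m) (seq b m)                                  ≡⟨ ℚ.+-identityʳ (antideriv n (seq z m) (seq b m)) ⟨
      antideriv n (seq z m) (seq b m) ℚ.- 0ℚ                           ≡⟨ cong (λ t → antideriv n (seq z m) (seq b m) ℚ.- t) (antideriv-0 n (seq z m)) ⟨
      antideriv n (seq z m) (seq b m) ℚ.- antideriv n (seq z m) 0ℚ     ∎
      where open ≡-Reasoning

  module _ (q y : ℝ) {r : ℕ → ℚ}
           (y≡q*r : ∀ m → seq y m ≡ seq q m ℚ.* r m)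
           (r[q-1]≡1 : Eventually (λ m → r m ℚ.* (seq q m ℚ.- 1ℚ) ≡ 1ℚ)) where

    private
      seq-lhs : ∀ m → seq ((q - 1ℝ) ^ suc n * antiderivℝ 1ℝ y) m ≡
        (seq q m ℚ.- 1ℚ) ℚ^.^ suc n ℚ.* antideriv n 1ℚ (seq q m ℚ.* r m)
      seq-lhs m = seq-* ((q - 1ℝ) ^ suc n) (antiderivℝ 1ℝ y) m (seq-^ (q - 1ℝ) (suc n) m)
        (seq-antiderivℝ′ 1ℝ y m refl (y≡q*r m))

      seq-rhs : ∀ m → seq (q * (q - 1ℝ) ^ n * antiderivℝ y 1ℝ) m ≡
        seq q m ℚ.* (seq q m ℚ.- 1ℚ) ℚ^.^ n ℚ.* antideriv n (seq q m ℚ.* r m) 1ℚ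
      seq-rhs m = seq-* (q * (q - 1ℝ) ^ n) (antiderivℝ y 1ℝ) m
        (seq-* q ((q - 1ℝ) ^ n) m refl (seq-^ (q - 1ℝ) n m))
        (seq-antiderivℝ′ y 1ℝ m (y≡q*r m) refl)

    𝔑-antiderivℝ : 𝔑 n {{n≢0}} q ≃ (q - 1ℝ) ^ suc n * antiderivℝ 1ℝ y
    𝔑-antiderivℝ = eventually-≡⇒≃ (𝔑 n {{n≢0}} q) ((q - 1ℝ) ^ suc n * antiderivℝ 1ℝ y) r[q-1]≡1 λ m eq →
      trans (seq-𝔑 q m) (trans (narayana-antideriv n {seq q m} {r m} eq) (sym (seq-lhs m)))

    antiderivℝ-substitution : (q - 1ℝ) ^ suc n * antiderivℝ 1ℝ y ≃ q * (q - 1ℝ) ^ n * antiderivℝ y 1ℝ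
    antiderivℝ-substitution = eventually-≡⇒≃ ((q - 1ℝ) ^ suc n * antiderivℝ 1ℝ y) (q * (q - 1ℝ) ^ n * antiderivℝ y 1ℝ)
      r[q-1]≡1 λ m eq → trans (seq-lhs m) (trans (antideriv-substitution n {seq q m} {r m} eq) (sym (seq-rhs m)))

    narayana-legendre-integral : ∀ c → (∀ m → seq c m ≡ ι 2 ℚ.* seq y m) → ∃[ I ] ∃[ J ]
      ( IsIntegral (λ x → P n (2ℝ * x - 1ℝ)) 0ℝ y I
      × IsIntegral (λ x → P n (c * x - 1ℝ)) 0ℝ 1ℝ J
      × 𝔑 n {{n≢0}} q ≃ (q - 1ℝ) ^ suc n * I
      × (q - 1ℝ) ^ suc n * I ≃ q * (q - 1ℝ) ^ n * J )
    narayana-legendre-integral c c≡2y =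
        antiderivℝ 1ℝ y , antiderivℝ y 1ℝ
      , legendre-integral 1ℝ y 2ℝ (λ _ → refl) , legendre-integral y 1ℝ c c≡2y
      , 𝔑-antiderivℝ , antiderivℝ-substitution

theorem2p1 : (n : ℕ) → .{{_ : NonZero n}} → (q : ℝ) → (q≠1 : q # 1ℝ) →
    let q-1≠0 = x#y⇒x-y#0 q 1ℝ q≠1 in
    ∃[ I ] ∃[ J ]
    ( IsIntegral (λ x → P n (2ℝ * x - 1ℝ)) 0ℝ (q / (q - 1ℝ) [ q-1≠0 ]) I
    × IsIntegral (λ x → P n ((2ℝ * q) / (q - 1ℝ) [ q-1≠0 ] * x - 1ℝ)) 0ℝ 1ℝ J
    × 𝔑 n q ≃ (q - 1ℝ) ^ suc n * I
    × (q - 1ℝ) ^ suc n * I ≃ q * (q - 1ℝ) ^ n * J )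
theorem2p1 n {{n≢0}} q q≠1 =
  let q-1≠0 = x#y⇒x-y#0 q 1ℝ q≠1 in
  narayana-legendre-integral n {{n≢0}} q (q / (q - 1ℝ) [ q-1≠0 ]) {λ m → recip (seq q m ℚ.- 1ℚ)}
    (λ _ → refl) (recip-eventually (q - 1ℝ) q-1≠0)
    -- The theorem groups this coefficient as (2q) · 1/(q - 1), the lemma as 2 · (q · 1/(q - 1)).
    ((2ℝ * q) / (q - 1ℝ) [ q-1≠0 ]) (λ m → ℚ.*-assoc (ι 2) (seq q m) (recip (seq q m ℚ.- 1ℚ)))
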